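{- Let $k\ge 1$ be an integer, let $n\ge 1$ be an integer divisible by $2k$, and put $d:=\frac{n}{2k}$. Then there is a unique (up to scale) nonzero homogeneous $\mathrm{SL}_n$-invariant polynomial $\mathrm{Pf}_{k,n}$ of degree $d$ on $\bigotimes^{2k}\mathbb{C}^n$; that is, the space of $\mathrm{SL}_n$-invariants in $\mathbb{C}[\bigotimes^{2k}\mathbb{C}^n]_{d}$ is one-dimensional. Under the identification of homogeneous degree-$d$ polynomials on $\bigotimes^{2k}\mathbb{C}^n$ with symmetric tensors, $\mathrm{Pf}_{k,n}$ corresponds (up to scale) to the tensor $e_1\wedge\cdots\wedge e_n$, which, regarded as an element of $\bigotimes^{n}\mathbb{C}^n\simeq\bigotimes^d\bigotimes^{2k}\mathbb{C}^n$, lies in $\mathrm{Sym}^d\bigotimes^{2k}\mathbb{C}^n$. Moreover, there are no non-constant $\mathrm{SL}_n$-invariants in lower degrees, i.e. for every integer $d'$ with $0<d'<\frac{n}{2k}$ the only $\mathrm{SL}_n$-invariant in $\mathbb{C}[\bigotimes^{2k}\mathbb{C}^n]_{d'}$ is $0$.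
   Context: The ground field is $\mathbb{C}$. $\mathrm{SL}_n$ is the group of complex $n\times n$ matrices of determinant $1$. It acts on $\bigotimes^m\mathbb{C}^n$ by $g(v_1\otimes\cdots\otimes v_m):=(gv_1)\otimes\cdots\otimes(gv_m)$, extended linearly. For a finite-dimensional $\mathrm{SL}_n$-representation $W$, $\mathbb{C}[W]_d$ denotes the space of homogeneous degree-$d$ polynomial functions on $W$. For $W=\bigotimes^m\mathbb{C}^n$, $\mathrm{SL}_n$ acts on polynomial functions by $(gf)(w):=f(g^t w)$, and $f$ is called invariant if $gf=f$ for all $g\in\mathrm{SL}_n$. $\mathrm{Sym}^d W$ is the subspace of $\mathfrak{S}_d$-invariant tensors in $\bigotimes^d W$, where the symmetric group $\mathfrak{S}_d$ permutes the $d$ tensor factors. The space $\bigotimes^m\mathbb{C}^n$ carries the standard inner product (standard basis tensors are orthonormal; the inner product is linear in its second argument), and $\bigotimes^d\bigotimes^m\mathbb{C}^n\simeq\bigotimes^{dm}\mathbb{C}^n$ carries the induced one. A symmetric tensor $t\in\mathrm{Sym}^d\bigotimes^m\mathbb{C}^n$ is identified with the homogeneous degree-$d$ polynomial $f(w):=\langle t,w^{\otimes d}\rangle$. $e_1,\dots,e_n$ is the standard basis of $\mathbb{C}^n$, and $e_1\wedge\cdots\wedge e_n:=\frac{1}{n!}\sum_{\pi\in\mathfrak{S}_n}\mathrm{sgn}(\pi)\,e_{\pi(1)}\otimes\cdots\otimes e_{\pi(n)}\in\bigotimes^n\mathbb{C}^n$. The identification $\bigotimes^{n}\mathbb{C}^n\simeq\bigotimes^d\bigotimes^{2k}\mathbb{C}^n$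 for $n=2kd$ groups the $n$ tensor factors into $d$ consecutive blocks of length $2k$. -}

module Defs where

open import Data.Fin.Base using (Fin)
import Data.Fin.Properties as Fin
open import Data.Fin.Permutation using (Permutation′; _⟨$⟩ʳ_)
open import Data.Integer.Base using (1ℤ)
open import Data.List.Base as List using (List; []; _∷_)
open import Data.Nat.Base as ℕ using (ℕ; zero; suc; _!; _⊔_)
import Data.Nat.Properties as ℕ
open import Data.Product.Base using (∃; _×_; _,_; proj₁; proj₂)
open import Data.Rational.Base as ℚ using (ℚ; 0ℚ; 1ℚ; ½; Positive)
import Data.Rational.Properties as ℚ
import Data.Rational.Solver as ℚ-Solver
open import Data.Sum.Base using (_⊎_)
open import Data.Vec.Base as Vec using (Vec; []; _∷_)
import Data.Vec.Relation.Unary.AllPairs as AllPairs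
open import Data.Vec.Relation.Unary.Unique.Propositional using (Unique)
open import Function.Base using (const)
open import Function.Bundles using (_⇔_)
open import Relation.Binary.PropositionalEquality
  using (_≡_; refl; sym; trans; cong; subst)
open import Relation.Nullary.Decidable using (Dec; yes; no; ¬?)

------------------------------------------------------------------------
-- Real numbers: Cauchy sequences of rationals, carrying a modulus of
-- convergence, up to the relation ≈ℝ.

Cauchy : (ℕ → ℚ) → Set
Cauchy x = ∀ (ε : ℚ) .{{_ : Positive ε}} →
  ∃ λ N → ∀ m n → N ℕ.≤ m → N ℕ.≤ n → ℚ.∣ x m ℚ.- x n ∣ ℚ.< ε

record ℝ : Set where
  constructor mkℝ
  field
    seq    : ℕ → ℚ
    cauchy : Cauchy seq

open ℝ public

infix 4 _≈ℝ_ _#ℝ_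

_≈ℝ_ : ℝ → ℝ → Set
x ≈ℝ y = ∀ (ε : ℚ) .{{_ : Positive ε}} →
  ∃ λ N → ∀ n → N ℕ.≤ n → ℚ.∣ seq x n ℚ.- seq y n ∣ ℚ.< ε

-- Constructive inequality; x #ℝ y implies ¬ (x ≈ℝ y).
_#ℝ_ : ℝ → ℝ → Set
x #ℝ y = ∃ λ (ε : ℚ) → Positive ε ×
  ∃ λ N → ∀ n → N ℕ.≤ n → ε ℚ.≤ ℚ.∣ seq x n ℚ.- seq y n ∣

½ε : ∀ ε .{{_ : Positive ε}} → Positive (½ ℚ.* ε)
½ε ε = ℚ.pos*pos⇒pos ½ ε

halves : ∀ ε → ½ ℚ.* ε ℚ.+ ½ ℚ.* ε ≡ ε
halves ε = trans (sym (ℚ.*-distribʳ-+ ε ½ ½)) (ℚ.*-identityˡ ε)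

bounded : ∀ {x} → Cauchy x →
  ∃ λ (B : ℚ) → Positive B × ∃ λ N → ∀ n → N ℕ.≤ n → ℚ.∣ x n ∣ ℚ.≤ B
bounded {x} cx with cx 1ℚ
... | N , close = 1ℚ ℚ.+ ℚ.∣ x N ∣
  , ℚ.pos+nonNeg⇒pos 1ℚ ℚ.∣ x N ∣ {{ℚ.∣-∣-nonNeg (x N)}}
  , N , λ n N≤n → begin
      ℚ.∣ x n ∣                         ≡⟨ cong ℚ.∣_∣ (split (x n) (x N)) ⟩
      ℚ.∣ (x n ℚ.- x N) ℚ.+ x N ∣        ≤⟨ ℚ.∣p+q∣≤∣p∣+∣q∣ (x n ℚ.- x N) (x N) ⟩
      ℚ.∣ x n ℚ.- x N ∣ ℚ.+ ℚ.∣ x N ∣    ≤⟨ ℚ.+-monoˡ-≤ ℚ.∣ x N ∣ (ℚ.<⇒≤ (close n N N≤n ℕ.≤-refl)) ⟩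
      1ℚ ℚ.+ ℚ.∣ x N ∣                  ∎
  where
  open ℚ.≤-Reasoning
  open ℚ-Solver.+-*-Solver
  split : ∀ p q → p ≡ (p ℚ.- q) ℚ.+ q
  split = solve 2 (λ p q → p := (p :- q) :+ q) refl

_÷₊_ : ℚ → (B : ℚ) → .{{Positive B}} → ℚ
(η ÷₊ B) = η ℚ.* (ℚ.1/ B) {{ℚ.pos⇒nonZero B}}

÷₊-pos : ∀ η B .{{_ : Positive η}} .{{_ : Positive B}} → Positive (η ÷₊ B)
÷₊-pos η B = ℚ.pos*pos⇒pos η ((ℚ.1/ B) {{ℚ.pos⇒nonZero B}}) {{ℚ.1/pos⇒pos B}}

*-small : ∀ B η .{{_ : Positive B}} p q →
  ℚ.∣ p ∣ ℚ.≤ B → ℚ.∣ q ∣ ℚ.< η ÷₊ B → ℚ.∣ p ℚ.* q ∣ ℚ.< η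
*-small B η p q p≤B q<δ = begin-strict
  ℚ.∣ p ℚ.* q ∣          ≡⟨ ℚ.∣p*q∣≡∣p∣*∣q∣ p q ⟩
  ℚ.∣ p ∣ ℚ.* ℚ.∣ q ∣     ≤⟨ ℚ.*-monoʳ-≤-nonNeg ℚ.∣ q ∣ {{ℚ.∣-∣-nonNeg q}} p≤B ⟩
  B ℚ.* ℚ.∣ q ∣          <⟨ ℚ.*-monoʳ-<-pos B q<δ ⟩
  B ℚ.* (η ℚ.* 1/B)      ≡⟨ ℚ.*-comm B (η ℚ.* 1/B) ⟩
  η ℚ.* 1/B ℚ.* B        ≡⟨ ℚ.*-assoc η 1/B B ⟩
  η ℚ.* (1/B ℚ.* B)      ≡⟨ cong (η ℚ.*_) (ℚ.*-inverseˡ B {{ℚ.pos⇒nonZero B}}) ⟩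
  η ℚ.* 1ℚ              ≡⟨ ℚ.*-identityʳ η ⟩
  η                     ∎
  where
  open ℚ.≤-Reasoning
  1/B = (ℚ.1/ B) {{ℚ.pos⇒nonZero B}}

+-small : ∀ {ε} p q →
  ℚ.∣ p ∣ ℚ.< ½ ℚ.* ε → ℚ.∣ q ∣ ℚ.< ½ ℚ.* ε → ℚ.∣ p ℚ.+ q ∣ ℚ.< ε
+-small {ε} p q p<½ε q<½ε = begin-strict
  ℚ.∣ p ℚ.+ q ∣          ≤⟨ ℚ.∣p+q∣≤∣p∣+∣q∣ p q ⟩
  ℚ.∣ p ∣ ℚ.+ ℚ.∣ q ∣     <⟨ ℚ.+-mono-< p<½ε q<½ε ⟩
  ½ ℚ.* ε ℚ.+ ½ ℚ.* ε    ≡⟨ halves ε ⟩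
  ε                     ∎
  where open ℚ.≤-Reasoning

const-cauchy : ∀ q → Cauchy (const q)
const-cauchy q ε = 0 , λ _ _ _ _ →
  subst (ℚ._< ε) (sym (cong ℚ.∣_∣ (ℚ.+-inverseʳ q))) (ℚ.positive⁻¹ ε)

+-cauchy : ∀ {x y} → Cauchy x → Cauchy y → Cauchy (λ n → x n ℚ.+ y n)
+-cauchy {x} {y} cx cy ε
  with cx (½ ℚ.* ε) {{½ε ε}} | cy (½ ℚ.* ε) {{½ε ε}}
... | M , px | N , py = M ⊔ N , λ m n m≥ n≥ →
  subst (λ z → ℚ.∣ z ∣ ℚ.< ε) (regroup (x m) (x n) (y m) (y n))
    (+-small (x m ℚ.- x n) (y m ℚ.- y n)
      (px m n (ℕ.m⊔n≤o⇒m≤o M N m≥) (ℕ.m⊔n≤o⇒m≤o M N n≥))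
      (py m n (ℕ.m⊔n≤o⇒n≤o M N m≥) (ℕ.m⊔n≤o⇒n≤o M N n≥)))
  where
  open ℚ-Solver.+-*-Solver
  regroup : ∀ a b c d → (a ℚ.- b) ℚ.+ (c ℚ.- d) ≡ (a ℚ.+ c) ℚ.- (b ℚ.+ d)
  regroup = solve 4 (λ a b c d → (a :- b) :+ (c :- d) := (a :+ c) :- (b :+ d)) refl

neg-cauchy : ∀ {x} → Cauchy x → Cauchy (λ n → ℚ.- x n)
neg-cauchy {x} cx ε with cx ε
... | N , px = N , λ m n m≥ n≥ →
  subst (ℚ._< ε)
    (trans (sym (ℚ.∣-p∣≡∣p∣ (x m ℚ.- x n)))
           (cong ℚ.∣_∣ (ℚ.neg-distrib-+ (x m) (ℚ.- x n))))
    (px m n m≥ n≥)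

*-close : ∀ ε A B .{{_ : Positive A}} .{{_ : Positive B}} a b c d →
  ℚ.∣ a ∣ ℚ.≤ A → ℚ.∣ c ℚ.- d ∣ ℚ.< (½ ℚ.* ε) ÷₊ A →
  ℚ.∣ d ∣ ℚ.≤ B → ℚ.∣ a ℚ.- b ∣ ℚ.< (½ ℚ.* ε) ÷₊ B →
  ℚ.∣ a ℚ.* c ℚ.- b ℚ.* d ∣ ℚ.< ε
*-close ε A B a b c d a≤A c-d d≤B a-b =
  subst (λ z → ℚ.∣ z ∣ ℚ.< ε) (regroup a b c d)
    (+-small {ε} (a ℚ.* (c ℚ.- d)) (d ℚ.* (a ℚ.- b))
      (*-small A (½ ℚ.* ε) a (c ℚ.- d) a≤A c-d)
      (*-small B (½ ℚ.* ε) d (a ℚ.- b) d≤B a-b))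
  where
  open ℚ-Solver.+-*-Solver
  regroup : ∀ a b c d → a ℚ.* (c ℚ.- d) ℚ.+ d ℚ.* (a ℚ.- b) ≡ a ℚ.* c ℚ.- b ℚ.* d
  regroup = solve 4 (λ a b c d →
    a :* (c :- d) :+ d :* (a :- b) := a :* c :- b :* d) refl

*-cauchy : ∀ {x y} → Cauchy x → Cauchy y → Cauchy (λ n → x n ℚ.* y n)
*-cauchy {x} {y} cx cy ε = from-bounds (bounded {x} cx) (bounded {y} cy)
  where
  Bounded : (ℕ → ℚ) → Set
  Bounded z = ∃ λ (B : ℚ) → Positive B × ∃ λ N → ∀ n → N ℕ.≤ n → ℚ.∣ z n ∣ ℚ.≤ B

  from-bounds : Bounded x → Bounded y →
    ∃ λ N → ∀ m n → N ℕ.≤ m → N ℕ.≤ n →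
      ℚ.∣ x m ℚ.* y m ℚ.- x n ℚ.* y n ∣ ℚ.< ε
  from-bounds (A , A>0 , K , x≤A) (B , B>0 , L , y≤B) =
    (K ⊔ L) ⊔ (M ⊔ N) , λ m n m≥ n≥ →
      *-close ε A B {{A>0}} {{B>0}} (x m) (x n) (y m) (y n)
        (x≤A m (≥K m≥)) (proj₂ py m n (≥N m≥) (≥N n≥))
        (y≤B n (≥L n≥)) (proj₂ px m n (≥M m≥) (≥M n≥))
    where
    px = cx (_÷₊_ (½ ℚ.* ε) B {{B>0}}) {{÷₊-pos (½ ℚ.* ε) B {{½ε ε}} {{B>0}}}}
    py = cy (_÷₊_ (½ ℚ.* ε) A {{A>0}}) {{÷₊-pos (½ ℚ.* ε) A {{½ε ε}} {{A>0}}}}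
    M  = proj₁ px
    N  = proj₁ py
    ≥KL : ∀ {m} → (K ⊔ L) ⊔ (M ⊔ N) ℕ.≤ m → K ⊔ L ℕ.≤ m
    ≥KL = ℕ.m⊔n≤o⇒m≤o (K ⊔ L) (M ⊔ N)
    ≥MN : ∀ {m} → (K ⊔ L) ⊔ (M ⊔ N) ℕ.≤ m → M ⊔ N ℕ.≤ m
    ≥MN = ℕ.m⊔n≤o⇒n≤o (K ⊔ L) (M ⊔ N)
    ≥K : ∀ {m} → (K ⊔ L) ⊔ (M ⊔ N) ℕ.≤ m → K ℕ.≤ m
    ≥K p = ℕ.m⊔n≤o⇒m≤o K L (≥KL p)
    ≥L : ∀ {m} → (K ⊔ L) ⊔ (M ⊔ N) ℕ.≤ m → L ℕ.≤ m
    ≥L p = ℕ.m⊔n≤o⇒n≤o K L (≥KL p)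
    ≥M : ∀ {m} → (K ⊔ L) ⊔ (M ⊔ N) ℕ.≤ m → M ℕ.≤ m
    ≥M p = ℕ.m⊔n≤o⇒m≤o M N (≥MN p)
    ≥N : ∀ {m} → (K ⊔ L) ⊔ (M ⊔ N) ℕ.≤ m → N ℕ.≤ m
    ≥N p = ℕ.m⊔n≤o⇒n≤o M N (≥MN p)

fromℚ : ℚ → ℝ
fromℚ q = mkℝ (const q) (const-cauchy q)

infixl 6 _+ℝ_
infixl 7 _*ℝ_
infix  8 -ℝ_

_+ℝ_ : ℝ → ℝ → ℝ
x +ℝ y = mkℝ (λ n → seq x n ℚ.+ seq y n) (+-cauchy {seq x} {seq y} (cauchy x) (cauchy y))

-ℝ_ : ℝ → ℝ
-ℝ x = mkℝ (λ n → ℚ.- seq x n) (neg-cauchy {seq x} (cauchy x))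

_*ℝ_ : ℝ → ℝ → ℝ
x *ℝ y = mkℝ (λ n → seq x n ℚ.* seq y n) (*-cauchy {seq x} {seq y} (cauchy x) (cauchy y))

------------------------------------------------------------------------

record ℂ : Set where
  constructor _+i_
  field
    re im : ℝ

open ℂ public

infix  4 _≈_ _#_
infixl 6 _+_
infixl 7 _*_
infix  8 -_

_≈_ : ℂ → ℂ → Set
z ≈ w = re z ≈ℝ re w × im z ≈ℝ im w

_#_ : ℂ → ℂ → Set
z # w = re z #ℝ re w ⊎ im z #ℝ im w

fromℚℂ : ℚ → ℂ
fromℚℂ q = fromℚ q +i fromℚ 0ℚ

0ℂ 1ℂ : ℂ
0ℂ = fromℚℂ 0ℚ
1ℂ = fromℚℂ 1ℚ

_+_ : ℂ → ℂ → ℂ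
(a +i b) + (c +i d) = (a +ℝ c) +i (b +ℝ d)

-_ : ℂ → ℂ
- (a +i b) = (-ℝ a) +i (-ℝ b)

_*_ : ℂ → ℂ → ℂ
(a +i b) * (c +i d) = (a *ℝ c +ℝ -ℝ (b *ℝ d)) +i (a *ℝ d +ℝ b *ℝ c)

conj : ℂ → ℂ
conj (a +i b) = a +i (-ℝ b)

∑ : ∀ {A : Set} → List A → (A → ℂ) → ℂ
∑ []       f = 0ℂ
∑ (x ∷ xs) f = f x + ∑ xs f

∏ : ∀ {n} → Vec ℂ n → ℂ
∏ []       = 1ℂ
∏ (z ∷ zs) = z * ∏ zs

------------------------------------------------------------------------
-- A vector is given by its coordinates in a basis indexed by B.

Space : Set → Set
Space B = B → ℂ

ℂ^ : ℕ → Set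
ℂ^ n = Space (Fin n)

-- The basis of the d-th tensor power consists of the d-tuples of basis
-- elements.  Iterated powers are obtained as ⨂ d (Vec B m).
⨂ : ℕ → Set → Set
⨂ d B = Space (Vec B d)

infixr 7 _•_

_•_ : ∀ {B} → ℂ → Space B → Space B
(c • v) b = c * v b

pure : ∀ {B d} → Vec (Space B) d → ⨂ d B
pure vs bs = ∏ (Vec.zipWith (λ v b → v b) vs bs)

_^⊗_ : ∀ {B} → Space B → ∀ d → ⨂ d B
w ^⊗ d = pure (Vec.replicate d w)

tuples : ∀ {B : Set} → List B → ∀ d → List (Vec B d)
tuples bs zero    = List.[ [] ]
tuples bs (suc d) = List.cartesianProductWith _∷_ bs (tuples bs d)

indices : ∀ m n → List (Vec (Fin n) m)
indices m n = tuples (List.allFin n) m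

e : ∀ {n} → Fin n → ℂ^ n
e i j with i Fin.≟ j
... | yes _ = 1ℂ
... | no  _ = 0ℂ

-- The inner product, given the list of all basis elements.
inner : ∀ {B} → List B → Space B → Space B → ℂ
inner bs s t = ∑ bs (λ b → conj (s b) * t b)

permuteFactors : ∀ {B : Set} {d} → Permutation′ d → Vec B d → Vec B d
permuteFactors σ bs = Vec.tabulate (λ i → Vec.lookup bs (σ ⟨$⟩ʳ i))

-- Membership in Sym^d.
IsSymmetric : ∀ {B d} → ⨂ d B → Set
IsSymmetric {d = d} t = ∀ (σ : Permutation′ d) bs → t (permuteFactors σ bs) ≈ t bs

-- The identification of ⨂^(d·m) with ⨂^d ⨂^m by consecutive blocks.
blocks : ∀ {B n} d m → .(d ℕ.* m ≡ n) → ⨂ n B → ⨂ d (Vec B m)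
blocks d m eq t bss = t (Vec.cast eq (Vec.concat bss))

------------------------------------------------------------------------
-- Permutations π of Fin n in one-line notation, π(1) ∷ ⋯ ∷ π(n) ∷ [].

unique? : ∀ {m n} (π : Vec (Fin n) m) → Dec (Unique π)
unique? = AllPairs.allPairs? (λ i j → ¬? (i Fin.≟ j))

𝔖 : ∀ n → List (Vec (Fin n) n)
𝔖 n = List.filter unique? (indices n n)

inversions : ∀ {m n} → Vec (Fin n) m → ℕ
inversions []      = 0
inversions (i ∷ π) = Vec.count (Fin._<? i) π ℕ.+ inversions π

-1^ : ℕ → ℂ
-1^ zero    = 1ℂ
-1^ (suc r) = - -1^ r

sgn : ∀ {m n} → Vec (Fin n) m → ℂ
sgn π = -1^ (inversions π)

Matrix : ℕ → Set
Matrix n = Fin n → Fin n → ℂ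

_ᵗ : ∀ {n} → Matrix n → Matrix n
(g ᵗ) i j = g j i

det : ∀ {n} → Matrix n → ℂ
det {n} g = ∑ (𝔖 n) (λ π → sgn π * ∏ (Vec.zipWith g (Vec.allFin n) π))

SL : ∀ n → Matrix n → Set
SL n g = det g ≈ 1ℂ

_·_ : ∀ {n} → Matrix n → ℂ^ n → ℂ^ n
_·_ {n} g v i = ∑ (List.allFin n) (λ j → g i j * v j)

-- The linear extension of e_{j₁} ⊗ ⋯ ⊗ e_{jₘ} ↦ (g e_{j₁}) ⊗ ⋯ ⊗ (g e_{jₘ}).
act : ∀ {m n} → Matrix n → ⨂ m (Fin n) → ⨂ m (Fin n)
act {m} {n} g w I =
  ∑ (indices m n) (λ J → w J * pure (Vec.map (λ j → g · e j) J) I)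

-- e₁ ∧ ⋯ ∧ eₙ
wedge : ∀ n → ⨂ n (Fin n)
wedge n I = fromℚℂ ((1ℤ ℚ./ n !) {{n ℕ.!≢0}})
  * ∑ (𝔖 n) (λ π → sgn π * pure (Vec.map e π) I)

------------------------------------------------------------------------

-- A finite linear combination of monomials of degree d, each given as a
-- coefficient and the d coordinates whose product it is.
evaluate : ∀ {B d} → List (ℂ × Vec B d) → Space B → ℂ
evaluate ts w = ∑ ts (λ t → proj₁ t * ∏ (Vec.map w (proj₂ t)))

-- Membership in ℂ[W]_d.
IsHomogeneous : ∀ {B} → ℕ → (Space B → ℂ) → Set
IsHomogeneous {B} d f =
  ∃ λ (ts : List (ℂ × Vec B d)) → ∀ w → f w ≈ evaluate ts w

IsInvariant : ∀ {m n} → (⨂ m (Fin n) → ℂ) → Set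
IsInvariant {n = n} f = ∀ (g : Matrix n) → SL n g → ∀ w → f (act (g ᵗ) w) ≈ f w

-- The SL_n-invariants in ℂ[⨂^m ℂ^n]_d.
Invariants : ∀ m n d → (⨂ m (Fin n) → ℂ) → Set
Invariants m n d f = IsHomogeneous d f × IsInvariant f

-- f is a basis of the one-dimensional space P: it is a nonzero element and
-- P consists exactly of the scalar multiples of f.
IsOneDimensionalWithBasis : ∀ {W : Set} → ((W → ℂ) → Set) → (W → ℂ) → Set
IsOneDimensionalWithBasis P f =
  P f × (∃ λ w → f w # 0ℂ) ×
  (∀ g → P g ⇔ (∃ λ c → ∀ w → g w ≈ c * f w))

-- The polynomial identified with a tensor t ∈ Sym^d ⨂^m ℂ^n.
polynomialOf : ∀ {m n d} → ⨂ d (Vec (Fin n) m) → ⨂ m (Fin n) → ℂ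
polynomialOf {m} {n} {d} t w = inner (tuples (indices m n) d) t (w ^⊗ d)

{-# OPTIONS --safe #-}

-- Up to the factor 1/n!, the tensor e₁ ∧ ⋯ ∧ eₙ has coefficient ε(J) at e_J, where
-- ε is the sign, extended by zero to words with repetitions.  The corresponding
-- polynomial Pf(w) = ∑ ε(J₁⋯J_d) w(J₁)⋯w(J_d) is multiplied by det g under the
-- action of g, since an alternating function of n letters is determined by its
-- value on 1⋯n.  Blocks of even length can be permuted without changing ε; hence
-- the tensor is symmetric, and Pf is positive at the sum of the basis tensors of
-- the consecutive blocks of 1⋯n.
--
-- Conversely, let f be invariant of degree d′ with 0 < d′m ≤ n.  Suppose that some
-- monomial of f misses the letter j, and that i occurs in it.  The torus element t
-- with entries 2 at i and 1/2 at j scales this monomial by some q ≥ 2, and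
-- (t f - q f) / (1 - q) = f is an expression of f without it.  Hence f is zero if
-- d′m < n, and if d′m = n only the monomials of permutations remain.  Averaging
-- over signed permutation matrices then turns each of them into a multiple of Pf.

module Submission where

open import Algebra.Bundles using (CommutativeRing)
import Algebra.Properties.Ring
import Algebra.Solver.Ring.NaturalCoefficients.Default
open import Data.Empty using (⊥-elim)
open import Data.Fin.Base as Fin using (Fin; zero; suc)
open import Data.Fin.Permutation using (Permutation′; _⟨$⟩ʳ_; _⟨$⟩ˡ_; inverseˡ)
import Data.Fin.Properties as Fin
open import Data.Integer.Base using (1ℤ)
open import Data.List.Base as List using (List; []; _∷_; length)
import Data.List.Membership.DecPropositional as DecMembership
open import Data.List.Membership.Propositional using (_∈_; _∉_)
open import Data.List.Membership.Propositional.Properties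
  using (∈-allFin; ∈-∃++; ∈-cartesianProductWith⁺; ∈-++⁺ˡ; ∈-++⁺ʳ)
import Data.List.Properties as List
open import Data.List.Relation.Binary.Permutation.Propositional
  using (_↭_; refl; prep; swap; trans; ↭-sym; ↭-trans; ↭-reflexive; ↭⇒↭ₛ)
import Data.List.Relation.Binary.Permutation.Propositional.Properties as ↭
import Data.List.Relation.Binary.Permutation.Setoid.Properties as SetoidPerm
open import Data.List.Relation.Unary.All as All using (All; []; _∷_)
open import Data.List.Relation.Unary.All.Properties using (¬Any⇒All¬; ++⁻ʳ)
open import Data.List.Relation.Unary.AllPairs using (AllPairs; []; _∷_)
import Data.List.Relation.Unary.AllPairs.Properties as AllPairs
open import Data.List.Relation.Unary.Any using (here; there)
open import Data.List.Relation.Unary.Unique.Propositional using (Unique)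
import Data.List.Relation.Unary.Unique.Propositional.Properties as Unique
open import Data.Nat.Base as ℕ using (ℕ; zero; suc; _≤_; _<_; _⊔_) renaming (_*_ to _*ℕ_)
open import Data.Nat.Divisibility.Core using (_∣_; quotient; divides)
import Data.Nat.Properties as ℕ
open import Data.Product.Base using (∃; ∃₂; Σ-syntax; _×_; _,_; proj₁; proj₂)
open import Data.Rational.Base as ℚ using (ℚ; 0ℚ; 1ℚ; ½; Positive)
import Data.Rational.Properties as ℚ
import Data.Rational.Solver as ℚ-Solver
open import Data.Sum.Base using (_⊎_; inj₁; inj₂)
open import Data.Vec.Base as Vec using (Vec; []; _∷_; toList; concat; lookup)
import Data.Vec.Membership.Propositional.Properties as VecMembership
import Data.Vec.Properties as Vec
import Data.Vec.Relation.Unary.All as VecAll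
import Data.Vec.Relation.Unary.AllPairs as VecAllPairs
import Data.Vec.Relation.Unary.Any as VecAny
import Data.Vec.Relation.Unary.Any.Properties as VecAny
open import Data.Vec.Relation.Unary.Unique.Propositional using () renaming (Unique to VecUnique)
import Data.Vec.Relation.Unary.Unique.Propositional.Properties as VecUnique
open import Function.Base using (_∘_; id)
open import Function.Bundles using (mk⇔; _⇔_)
open import Level using (0ℓ)
open import Relation.Binary.Definitions using (DecidableEquality; tri<; tri≈; tri>)
open import Relation.Binary.PropositionalEquality as ≡
  using (_≡_; _≢_; refl; cong; cong₂; subst; setoid)
import Relation.Binary.Reasoning.Setoid
open import Relation.Nullary.Decidable using (yes; no)
open import Relation.Nullary.Negation using (¬_)
open import Relation.Unary using (Decidable)
open import Defs using (tuples; indices; permuteFactors)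

-- Equality of complex numbers is not decidable here, and different lists of monomials can define
-- the same function. Coefficients are therefore never compared or tested for zero: an invariant is
-- known only through some expression, and the converse keeps replacing this expression by another
-- one of the same function. Whatever has to be divided by, or shown to be apart from zero, is
-- exhibited as the image of a rational number, where order and inverses are available: `1 - q` for
-- a torus element, the number of permutations for the average, the value of the Pfaffian at the
-- chosen point. The torus entries 2 and 1/2 fit this scheme: a word that avoids `j` is scaled by a
-- power of 2, so one occurrence of `i` keeps the factor away from 1. The algebra is done over any
-- commutative ring that receives the rationals, and sums run over all words instead of over
-- permutations, because `ε` vanishes on repetitions. Such sums can be expanded letter by letter and
-- cut into blocks without leaving the index set.

private variable A B : Set

-- Lists without repetitions

∈⇒↭∷ : ∀ {x : A} {xs} → x ∈ xs → ∃ λ ys → xs ↭ x ∷ ys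
∈⇒↭∷ {x = x} x∈xs with ∈-∃++ x∈xs
... | ys , zs , refl = ys List.++ zs , ↭.shift x ys zs

Unique-resp-↭ : ∀ {xs ys : List A} → xs ↭ ys → Unique xs → Unique ys
Unique-resp-↭ {A} xs↭ys = SetoidPerm.Unique-resp-↭ (setoid A) (↭⇒↭ₛ xs↭ys)

-- Pigeonhole principle, by removing the head of `xs` from both lists. It is used with `allFin` on
-- either side: a word of `n` distinct letters contains every letter, and a word of at most `n`
-- letters that contains every letter has no repetition.
Unique-⊆⇒↭ : ∀ {xs ys : List A} → Unique xs → (∀ {x} → x ∈ xs → x ∈ ys) →
  length ys ≤ length xs → xs ↭ ys
Unique-⊆⇒↭ {xs = []}     {[]}    []       xs⊆ys _ = ↭-reflexive refl
Unique-⊆⇒↭ {xs = x ∷ xs} {ys} (x# ∷ u) xs⊆ys ys≤xs with ∈⇒↭∷ (xs⊆ys (here refl))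
... | zs , ys↭x∷zs = ↭-trans (prep x (Unique-⊆⇒↭ u xs⊆zs zs≤xs)) (↭-sym ys↭x∷zs)
  where
  xs⊆zs : ∀ {y} → y ∈ xs → y ∈ zs
  xs⊆zs y∈xs with ↭.∈-resp-↭ ys↭x∷zs (xs⊆ys (there y∈xs))
  ... | here refl  = ⊥-elim (All.lookup x# y∈xs refl)
  ... | there y∈zs = y∈zs
  zs≤xs : length zs ≤ length xs
  zs≤xs = ℕ.s≤s⁻¹ (subst (_≤ suc (length xs)) (↭.↭-length ys↭x∷zs) ys≤xs)

-- The two equal letters are moved to the front, the position in which exchanging them shows that an
-- alternating function vanishes.
unique-or-repetition : DecidableEquality A → (xs : List A) →
  Unique xs ⊎ ∃₂ λ x ys → xs ↭ x ∷ x ∷ ys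
unique-or-repetition _≟_ [] = inj₁ []
unique-or-repetition _≟_ (x ∷ xs) with DecMembership._∈?_ _≟_ x xs
... | yes x∈xs = inj₂ (x , proj₁ (∈⇒↭∷ x∈xs) , prep x (proj₂ (∈⇒↭∷ x∈xs)))
... | no x∉xs with unique-or-repetition _≟_ xs
... | inj₁ u             = inj₁ (¬Any⇒All¬ xs x∉xs ∷ u)
... | inj₂ (y , ys , p)  = inj₂ (y , x ∷ ys ,
        ↭-trans (prep x p) (↭-trans (swap x y (↭-reflexive refl)) (prep y (swap x y (↭-reflexive refl)))))

-- Words in the letters of `Fin n`

module _ {n : ℕ} where
  open DecMembership (Fin._≟_ {n}) using (_∈?_)

  length-allFin : length (List.allFin n) ≡ n
  length-allFin = List.length-tabulate (λ i → i)

  Unique⇒allFin-↭ : ∀ {xs} → length xs ≡ n → Unique xs → List.allFin n ↭ xs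
  Unique⇒allFin-↭ eq u = ↭-sym (Unique-⊆⇒↭ u (λ {i} _ → ∈-allFin i)
    (ℕ.≤-reflexive (≡.trans length-allFin (≡.sym eq))))

  missing-or-⊇ : ∀ (xs : List (Fin n)) → (∃ λ i → i ∉ xs) ⊎ (∀ i → i ∈ xs)
  missing-or-⊇ xs with Fin.all? (_∈? xs)
  ... | yes all∈ = inj₂ all∈
  ... | no ¬all∈ = inj₁ (Fin.¬∀⟶∃¬ n (_∈ xs) (_∈? xs) ¬all∈)

  ⊇⇒allFin-↭ : ∀ {xs} → length xs ≤ n → (∀ i → i ∈ xs) → List.allFin n ↭ xs
  ⊇⇒allFin-↭ len≤n all∈ = Unique-⊆⇒↭ (Unique.allFin⁺ n) (λ {i} _ → all∈ i)
    (ℕ.≤-trans len≤n (ℕ.≤-reflexive (≡.sym length-allFin)))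

module Tensors (R : CommutativeRing 0ℓ 0ℓ) where

  open CommutativeRing R public
    using (_≈_; _+_; _*_; -_; 0#; 1#; commutativeSemiring; ring
          ; +-cong; +-congˡ; +-congʳ; +-assoc; +-comm; +-identityˡ; +-identityʳ
          ; *-cong; *-congˡ; *-congʳ; *-assoc; *-comm; *-identityˡ; *-identityʳ
          ; distribˡ; zeroˡ; zeroʳ; -‿cong; -‿inverseˡ; -‿inverseʳ)
    renaming (Carrier to K; refl to ≈-refl; sym to ≈-sym; trans to ≈-trans; reflexive to ≡⇒≈)
  module ≈-Reasoning = Relation.Binary.Reasoning.Setoid (CommutativeRing.setoid R)
  open Algebra.Properties.Ring ring public
    using (-‿distribˡ-*; -‿distribʳ-*; -‿involutive; -0#≈0#; -1*x≈-x)
  module R-Solver = Algebra.Solver.Ring.NaturalCoefficients.Default commutativeSemiring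

  -- Finite sums and products

  ∑ : List A → (A → K) → K
  ∑ []       f = 0#
  ∑ (x ∷ xs) f = f x + ∑ xs f

  ∏ : ∀ {n} → Vec K n → K
  ∏ []       = 1#
  ∏ (x ∷ xs) = x * ∏ xs

  ∑-cong∈ : ∀ (xs : List A) {f g} → (∀ {x} → x ∈ xs → f x ≈ g x) → ∑ xs f ≈ ∑ xs g
  ∑-cong∈ []       f≈g = ≈-refl
  ∑-cong∈ (x ∷ xs) f≈g = +-cong (f≈g (here refl)) (∑-cong∈ xs (f≈g ∘ there))

  ∑-cong : ∀ (xs : List A) {f g} → (∀ x → f x ≈ g x) → ∑ xs f ≈ ∑ xs g
  ∑-cong xs f≈g = ∑-cong∈ xs (λ {x} _ → f≈g x)

  ∑-zero : ∀ (xs : List A) → ∑ xs (λ _ → 0#) ≈ 0#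
  ∑-zero []       = ≈-refl
  ∑-zero (x ∷ xs) = ≈-trans (+-identityˡ _) (∑-zero xs)

  ∑-+ : ∀ (xs : List A) f g → ∑ xs (λ x → f x + g x) ≈ ∑ xs f + ∑ xs g
  ∑-+ []       f g = ≈-sym (+-identityˡ 0#)
  ∑-+ (x ∷ xs) f g = ≈-trans (+-cong ≈-refl (∑-+ xs f g))
    (solve 4 (λ a b c d → (a :+ b) :+ (c :+ d) := (a :+ c) :+ (b :+ d)) ≈-refl _ _ _ _)
    where open R-Solver

  ∑-*ˡ : ∀ c (xs : List A) f → c * ∑ xs f ≈ ∑ xs (λ x → c * f x)
  ∑-*ˡ c []       f = zeroʳ c
  ∑-*ˡ c (x ∷ xs) f = ≈-trans (distribˡ c (f x) (∑ xs f)) (+-cong ≈-refl (∑-*ˡ c xs f))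

  ∑-*ʳ : ∀ c (xs : List A) f → ∑ xs f * c ≈ ∑ xs (λ x → f x * c)
  ∑-*ʳ c xs f = ≈-trans (*-comm _ c) (≈-trans (∑-*ˡ c xs f) (∑-cong xs (λ x → *-comm c (f x))))

  ∑-swap : ∀ (xs : List A) (ys : List B) (f : A → B → K) →
    ∑ xs (λ x → ∑ ys (f x)) ≈ ∑ ys (λ y → ∑ xs (λ x → f x y))
  ∑-swap []       ys f = ≈-sym (∑-zero ys)
  ∑-swap (x ∷ xs) ys f =
    ≈-trans (+-cong ≈-refl (∑-swap xs ys f)) (≈-sym (∑-+ ys (f x) (λ y → ∑ xs (λ x → f x y))))

  ∑-++ : ∀ (xs ys : List A) f → ∑ (xs List.++ ys) f ≈ ∑ xs f + ∑ ys f
  ∑-++ []       ys f = ≈-sym (+-identityˡ _)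
  ∑-++ (x ∷ xs) ys f = ≈-trans (+-cong ≈-refl (∑-++ xs ys f)) (≈-sym (+-assoc _ _ _))

  ∑-map : ∀ (g : A → B) xs f → ∑ (List.map g xs) f ≡ ∑ xs (f ∘ g)
  ∑-map g []       f = refl
  ∑-map g (x ∷ xs) f = cong (f (g x) +_) (∑-map g xs f)

  -- The summands need to agree only where `P` holds; this suits the sign given by inversions, which
  -- is compared with `ε` on words without repetitions only.
  ∑-filter : ∀ {P : A → Set} (P? : Decidable P) xs {f g} →
    (∀ x → P x → f x ≈ g x) → (∀ x → ¬ P x → g x ≈ 0#) → ∑ (List.filter P? xs) f ≈ ∑ xs g
  ∑-filter P? []       f≈g g≈0 = ≈-refl
  ∑-filter P? (x ∷ xs) f≈g g≈0 with P? x
  ... | yes p = +-cong (f≈g x p) (∑-filter P? xs f≈g g≈0)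
  ... | no ¬p = ≈-trans (∑-filter P? xs f≈g g≈0)
    (≈-trans (≈-sym (+-identityˡ _)) (+-cong (≈-sym (g≈0 x ¬p)) ≈-refl))

  ∑-tuples : ∀ (bs : List B) d (f : Vec B (suc d) → K) →
    ∑ (tuples bs (suc d)) f ≈ ∑ bs (λ b → ∑ (tuples bs d) (λ t → f (b ∷ t)))
  ∑-tuples {B} bs d f = go bs
    where
    go : ∀ cs → ∑ (List.cartesianProductWith _∷_ cs (tuples bs d)) f ≈
         ∑ cs (λ b → ∑ (tuples bs d) (λ t → f (b ∷ t)))
    go []       = ≈-refl
    go (c ∷ cs) = ≈-trans (∑-++ (List.map (c ∷_) (tuples bs d)) _ f)
      (+-cong (≡⇒≈ (∑-map (c ∷_) (tuples bs d) f)) (go cs))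

  ∏-cong : ∀ {n} (xs : Vec A n) {f g : A → K} → (∀ x → f x ≈ g x) →
    ∏ (Vec.map f xs) ≈ ∏ (Vec.map g xs)
  ∏-cong []       f≈g = ≈-refl
  ∏-cong (x ∷ xs) f≈g = *-cong (f≈g x) (∏-cong xs f≈g)

  ∏-zipWith-cong : ∀ {n} (xs : Vec A n) (ys : Vec B n) {f g : A → B → K} →
    (∀ x y → f x y ≈ g x y) → ∏ (Vec.zipWith f xs ys) ≈ ∏ (Vec.zipWith g xs ys)
  ∏-zipWith-cong []       []       f≈g = ≈-refl
  ∏-zipWith-cong (x ∷ xs) (y ∷ ys) f≈g = *-cong (f≈g x y) (∏-zipWith-cong xs ys f≈g)

  ∏-map-* : ∀ {n} (xs : Vec A n) (f g : A → K) →
    ∏ (Vec.map (λ x → f x * g x) xs) ≈ ∏ (Vec.map f xs) * ∏ (Vec.map g xs)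
  ∏-map-* []       f g = ≈-sym (*-identityˡ 1#)
  ∏-map-* (x ∷ xs) f g = ≈-trans (*-cong ≈-refl (∏-map-* xs f g))
    (solve 4 (λ a b c d → (a :* b) :* (c :* d) := (a :* c) :* (b :* d)) ≈-refl _ _ _ _)
    where open R-Solver

  ∏-zipWith-*ʳ : ∀ {n} (xs : Vec A n) (ys : Vec B n) (f : B → K) (g : A → B → K) →
    ∏ (Vec.zipWith (λ x y → f y * g x y) xs ys) ≈ ∏ (Vec.map f ys) * ∏ (Vec.zipWith g xs ys)
  ∏-zipWith-*ʳ []       []       f g = ≈-sym (*-identityˡ 1#)
  ∏-zipWith-*ʳ (x ∷ xs) (y ∷ ys) f g = ≈-trans (*-cong ≈-refl (∏-zipWith-*ʳ xs ys f g))
    (solve 4 (λ a b c d → (a :* b) :* (c :* d) := (a :* c) :* (b :* d)) ≈-refl _ _ _ _)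
    where open R-Solver

  ∏-map-concat : ∀ {m n} (f : A → K) (xss : Vec (Vec A m) n) →
    ∏ (Vec.map (λ xs → ∏ (Vec.map f xs)) xss) ≈ ∏ (Vec.map f (Vec.concat xss))
  ∏-map-concat f []         = ≈-refl
  ∏-map-concat f (xs ∷ xss) = ≈-trans (*-cong ≈-refl (∏-map-concat f xss)) (go xs)
    where
    go : ∀ {k l} (xs : Vec _ k) {ys : Vec _ l} →
         ∏ (Vec.map f xs) * ∏ (Vec.map f ys) ≈ ∏ (Vec.map f (xs Vec.++ ys))
    go []       = *-identityˡ _
    go (x ∷ xs) = ≈-trans (*-assoc _ _ _) (*-cong ≈-refl (go xs))

  ∏-zipWith-concat : ∀ {m n} (f : A → B → K) (xss : Vec (Vec A m) n) (yss : Vec (Vec B m) n) →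
    ∏ (Vec.zipWith (λ xs ys → ∏ (Vec.zipWith f xs ys)) xss yss) ≈
    ∏ (Vec.zipWith f (Vec.concat xss) (Vec.concat yss))
  ∏-zipWith-concat f []         []         = ≈-refl
  ∏-zipWith-concat f (xs ∷ xss) (ys ∷ yss) =
    ≈-trans (*-cong ≈-refl (∏-zipWith-concat f xss yss)) (go xs ys)
    where
    go : ∀ {k l} (xs : Vec _ k) (ys : Vec _ k) {us : Vec _ l} {vs} →
         ∏ (Vec.zipWith f xs ys) * ∏ (Vec.zipWith f us vs) ≈
         ∏ (Vec.zipWith f (xs Vec.++ us) (ys Vec.++ vs))
    go []       []       = *-identityˡ _
    go (x ∷ xs) (y ∷ ys) = ≈-trans (*-assoc _ _ _) (*-cong ≈-refl (go xs ys))

  ∏-∑ : ∀ {d} (as : Vec A d) (bs : List B) (f : A → B → K) →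
    ∏ (Vec.map (λ a → ∑ bs (f a)) as) ≈ ∑ (tuples bs d) (λ t → ∏ (Vec.zipWith f as t))
  ∏-∑ []       bs f = ≈-sym (+-identityʳ 1#)
  ∏-∑ {d = suc d} (a ∷ as) bs f = begin
    ∑ bs (f a) * ∏ (Vec.map (λ a → ∑ bs (f a)) as)
      ≈⟨ *-cong ≈-refl (∏-∑ as bs f) ⟩
    ∑ bs (f a) * ∑ (tuples bs d) (λ t → ∏ (Vec.zipWith f as t))
      ≈⟨ ∑-*ʳ _ bs (f a) ⟩
    ∑ bs (λ b → f a b * ∑ (tuples bs d) (λ t → ∏ (Vec.zipWith f as t)))
      ≈⟨ ∑-cong bs (λ b → ∑-*ˡ (f a b) (tuples bs d) _) ⟩
    ∑ bs (λ b → ∑ (tuples bs d) (λ t → f a b * ∏ (Vec.zipWith f as t)))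
      ≈⟨ ∑-tuples bs d (λ t → ∏ (Vec.zipWith f (a ∷ as) t)) ⟨
    ∑ (tuples bs (suc d)) (λ t → ∏ (Vec.zipWith f (a ∷ as) t)) ∎
    where open ≈-Reasoning

  -- Standard basis and Kronecker deltas

  e : ∀ {n} → Fin n → Fin n → K
  e i j with i Fin.≟ j
  ... | yes _ = 1#
  ... | no  _ = 0#

  e-diag : ∀ {n} (i : Fin n) → e i i ≈ 1#
  e-diag i with i Fin.≟ i
  ... | yes _  = ≈-refl
  ... | no i≢i = ⊥-elim (i≢i refl)

  e-off : ∀ {n} {i j : Fin n} → i ≢ j → e i j ≈ 0#
  e-off {i = i} {j} i≢j with i Fin.≟ j
  ... | yes i≡j = ⊥-elim (i≢j i≡j)
  ... | no _    = ≈-refl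

  e-sym : ∀ {n} (i j : Fin n) → e i j ≈ e j i
  e-sym i j with i Fin.≟ j
  ... | yes refl = ≈-sym (e-diag i)
  ... | no i≢j   = ≈-sym (e-off (i≢j ∘ ≡.sym))

  ∑-e : ∀ {n} (f : Fin n → K) i → ∑ (List.allFin n) (λ j → f j * e j i) ≈ f i
  ∑-e {n} f i = hit (List.allFin n) (Unique.allFin⁺ n) (∈-allFin i)
    where
    term : ∀ {j} → j ≢ i → f j * e j i ≈ 0#
    term j≢i = ≈-trans (*-cong ≈-refl (e-off j≢i)) (zeroʳ _)

    hit : ∀ xs → Unique xs → i ∈ xs → ∑ xs (λ j → f j * e j i) ≈ f i
    hit (x ∷ xs) (x# ∷ u) (here refl) = ≈-trans
      (+-cong (≈-trans (*-cong ≈-refl (e-diag i)) (*-identityʳ _))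
              (≈-trans (∑-cong∈ xs (λ y∈ → term (All.lookup x# y∈ ∘ ≡.sym))) (∑-zero xs)))
      (+-identityʳ _)
    hit (x ∷ xs) (x# ∷ u) (there i∈) = ≈-trans
      (+-cong (term (All.lookup x# i∈)) (hit xs u i∈)) (+-identityˡ _)

  -- The product is the Kronecker delta of the words `J` and `I`. Inserting it turns a later change
  -- of summation variable into an interchange of two sums.
  ∑-δ : ∀ {m n} (f : Vec (Fin n) m → K) I →
    ∑ (indices m n) (λ J → f J * ∏ (Vec.zipWith e J I)) ≈ f I
  ∑-δ f [] = ≈-trans (+-identityʳ _) (*-identityʳ _)
  ∑-δ {suc m} {n} f (i ∷ I) = begin
    ∑ (indices (suc m) n) (λ J → f J * ∏ (Vec.zipWith e J (i ∷ I)))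
      ≈⟨ ∑-tuples (List.allFin n) m _ ⟩
    ∑ (List.allFin n) (λ j → ∑ (indices m n) (λ J → f (j ∷ J) * (e j i * ∏ (Vec.zipWith e J I))))
      ≈⟨ ∑-cong (List.allFin n) (λ j → ≈-trans
           (∑-cong (indices m n) (λ J →
              solve 3 (λ a b c → a :* (b :* c) := b :* (a :* c)) ≈-refl (f (j ∷ J)) (e j i) _))
           (≈-sym (∑-*ˡ (e j i) (indices m n) _))) ⟩
    ∑ (List.allFin n) (λ j → e j i * ∑ (indices m n) (λ J → f (j ∷ J) * ∏ (Vec.zipWith e J I)))
      ≈⟨ ∑-cong (List.allFin n) (λ j → ≈-trans (*-cong ≈-refl (∑-δ (λ J → f (j ∷ J)) I)) (*-comm _ _)) ⟩
    ∑ (List.allFin n) (λ j → f (j ∷ I) * e j i)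
      ≈⟨ ∑-e (λ j → f (j ∷ I)) i ⟩
    f (i ∷ I) ∎
    where
    open ≈-Reasoning
    open R-Solver

  -- The action of the transpose of g.
  act : ∀ {m n} → (Fin n → Fin n → K) → (Vec (Fin n) m → K) → Vec (Fin n) m → K
  act {m} {n} g w I = ∑ (indices m n) (λ J → w J * ∏ (Vec.zipWith g J I))

  -- Expanding the product of sums chooses one word `J` for each factor. The matrix entries then
  -- depend on the concatenated words alone, which brings in the determinant.
  monomial-act : ∀ {m n d} (g : Fin n → Fin n → K) (w : Vec (Fin n) m → K) (Is : Vec (Vec (Fin n) m) d) →
    ∏ (Vec.map (act g w) Is) ≈
    ∑ (tuples (indices m n) d) (λ Js →
      ∏ (Vec.map w Js) * ∏ (Vec.zipWith g (Vec.concat Js) (Vec.concat Is)))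
  monomial-act {m} {n} {d} g w Is = begin
    ∏ (Vec.map (act g w) Is)
      ≈⟨ ∏-∑ Is (indices m n) (λ I J → w J * ∏ (Vec.zipWith g J I)) ⟩
    ∑ (tuples (indices m n) d) (λ Js → ∏ (Vec.zipWith (λ I J → w J * ∏ (Vec.zipWith g J I)) Is Js))
      ≈⟨ ∑-cong (tuples (indices m n) d) (λ Js → ≈-trans
           (∏-zipWith-*ʳ Is Js w (λ I J → ∏ (Vec.zipWith g J I)))
           (*-cong ≈-refl (≈-trans (∏-flip Js Is) (∏-zipWith-concat g Js Is)))) ⟩
    ∑ (tuples (indices m n) d) (λ Js →
      ∏ (Vec.map w Js) * ∏ (Vec.zipWith g (Vec.concat Js) (Vec.concat Is))) ∎
    where
    open ≈-Reasoning
    ∏-flip : ∀ {k} (Js Is : Vec (Vec (Fin n) m) k) →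
      ∏ (Vec.zipWith (λ I J → ∏ (Vec.zipWith g J I)) Is Js) ≈
      ∏ (Vec.zipWith (λ J I → ∏ (Vec.zipWith g J I)) Js Is)
    ∏-flip []       []       = ≈-refl
    ∏-flip (J ∷ Js) (I ∷ Is) = *-cong ≈-refl (∏-flip Js Is)

  -- Signs and alternating functions

  -- The sign belongs to a derivation and not to its endpoints: a list with a repetition has
  -- derivations of both signs to itself, which is what forces functions satisfying `Alternating` to
  -- vanish there when 2 is invertible.
  sign : ∀ {xs ys : List A} → xs ↭ ys → K
  sign refl         = 1#
  sign (prep x p)   = sign p
  sign (swap x y p) = - sign p
  sign (trans p q)  = sign p * sign q

  -x*-y≈x*y : ∀ x y → - x * - y ≈ x * y
  -x*-y≈x*y x y = ≈-trans (≈-sym (-‿distribˡ-* x (- y)))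
    (≈-trans (-‿cong (≈-sym (-‿distribʳ-* x y))) (-‿involutive (x * y)))

  sign² : ∀ {xs ys : List A} (p : xs ↭ ys) → sign p * sign p ≈ 1#
  sign² refl         = *-identityˡ 1#
  sign² (prep x p)   = sign² p
  sign² (swap x y p) = ≈-trans (-x*-y≈x*y (sign p) (sign p)) (sign² p)
  sign² (trans p q)  = ≈-trans
    (solve 2 (λ a b → (a :* b) :* (a :* b) := (a :* a) :* (b :* b)) ≈-refl (sign p) (sign q))
    (≈-trans (*-cong (sign² p) (sign² q)) (*-identityˡ 1#))
    where open R-Solver

  sign-map⁺ : ∀ (f : A → B) {xs ys} (p : xs ↭ ys) → sign (↭.map⁺ f p) ≈ sign p
  sign-map⁺ f refl         = ≈-refl
  sign-map⁺ f (prep x p)   = sign-map⁺ f p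
  sign-map⁺ f (swap x y p) = -‿cong (sign-map⁺ f p)
  sign-map⁺ f (trans p q)  = *-cong (sign-map⁺ f p) (sign-map⁺ f q)

  Alternating : (List A → K) → Set
  Alternating {A} α = ∀ {xs ys : List A} (p : xs ↭ ys) → α ys ≈ sign p * α xs

  alternating-map : ∀ {α : List B → K} (f : A → B) → Alternating α → Alternating (α ∘ List.map f)
  alternating-map f alt p = ≈-trans (alt (↭.map⁺ f p)) (*-congʳ (sign-map⁺ f p))

  alternating-∷ : ∀ {α : List A → K} x → Alternating α → Alternating (α ∘ (x ∷_))
  alternating-∷ x alt p = alt (prep x p)

  alternating-swap : ∀ {α : List A → K} → Alternating α → ∀ x y xs → α (y ∷ x ∷ xs) ≈ - α (x ∷ y ∷ xs)
  alternating-swap alt x y xs = ≈-trans (alt (swap x y refl)) (-1*x≈-x _)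

  -- The sign of `j - i`, so that `ε` becomes the product of these signs over all pairs of
  -- positions, and a repeated letter contributes a factor zero.
  ord : ∀ {n} → Fin n → Fin n → K
  ord i j with Fin.<-cmp i j
  ... | tri< _ _ _ = 1#
  ... | tri≈ _ _ _ = 0#
  ... | tri> _ _ _ = - 1#

  ord-antisym : ∀ {n} (i j : Fin n) → ord j i ≈ - ord i j
  ord-antisym i j with Fin.<-cmp i j | Fin.<-cmp j i
  ... | tri< _ _ _    | tri> _ _ _    = ≈-refl
  ... | tri≈ _ _ _    | tri≈ _ _ _    = ≈-sym -0#≈0#
  ... | tri> _ _ _    | tri< _ _ _    = ≈-sym (-‿involutive 1#)
  ... | tri< _ _ j≮i  | tri< j<i _ _  = ⊥-elim (j≮i j<i)
  ... | tri< _ i≢j _  | tri≈ _ j≡i _  = ⊥-elim (i≢j (≡.sym j≡i))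
  ... | tri≈ _ i≡j _  | tri< _ j≢i _  = ⊥-elim (j≢i (≡.sym i≡j))
  ... | tri≈ _ i≡j _  | tri> _ j≢i _  = ⊥-elim (j≢i (≡.sym i≡j))
  ... | tri> _ i≢j _  | tri≈ _ j≡i _  = ⊥-elim (i≢j (≡.sym j≡i))
  ... | tri> i≮j _ _  | tri> _ _ i<j  = ⊥-elim (i≮j i<j)

  ord-∏ : ∀ {n} → Fin n → List (Fin n) → K
  ord-∏ i []       = 1#
  ord-∏ i (j ∷ js) = ord i j * ord-∏ i js

  -- The sign of a permutation in one-line notation, extended by zero to
  -- lists with repetitions.
  ε : ∀ {n} → List (Fin n) → K
  ε []       = 1#
  ε (i ∷ is) = ord-∏ i is * ε is

  ord-∏-↭ : ∀ {n} (i : Fin n) {js ks} → js ↭ ks → ord-∏ i js ≈ ord-∏ i ks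
  ord-∏-↭ i refl         = ≈-refl
  ord-∏-↭ i (prep x p)   = *-congˡ (ord-∏-↭ i p)
  ord-∏-↭ i (swap x y p) = ≈-trans (*-congˡ (*-congˡ (ord-∏-↭ i p)))
    (solve 3 (λ a b c → a :* (b :* c) := b :* (a :* c)) ≈-refl (ord i x) (ord i y) _)
    where open R-Solver
  ord-∏-↭ i (trans p q)  = ≈-trans (ord-∏-↭ i p) (ord-∏-↭ i q)

  -- The product `ord-∏ i` does not depend on the order of the letters after `i`. In an exchange of
  -- neighbours only their common factor `ord x y` changes, and it changes sign.
  ε-alternating : ∀ {n} → Alternating (ε {n})
  ε-alternating refl = ≈-sym (*-identityˡ _)
  ε-alternating (prep {xs} {ys} x p) = ≈-trans
    (*-cong (ord-∏-↭ x (↭-sym p)) (ε-alternating p))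
    (solve 3 (λ a b c → a :* (b :* c) := b :* (a :* c)) ≈-refl (ord-∏ x xs) (sign p) (ε xs))
    where open R-Solver
  ε-alternating (swap {xs} {ys} x y p) = begin
    (ord y x * ord-∏ y ys) * (ord-∏ x ys * ε ys)
      ≈⟨ *-cong (*-cong (ord-antisym x y) (ord-∏-↭ y (↭-sym p)))
                (*-cong (ord-∏-↭ x (↭-sym p)) (ε-alternating p)) ⟩
    (- ord x y * ord-∏ y xs) * (ord-∏ x xs * (sign p * ε xs))
      ≈⟨ *-congʳ (≈-sym (-‿distribˡ-* _ _)) ⟩
    - (ord x y * ord-∏ y xs) * (ord-∏ x xs * (sign p * ε xs))
      ≈⟨ -‿distribˡ-* _ _ ⟨
    - ((ord x y * ord-∏ y xs) * (ord-∏ x xs * (sign p * ε xs)))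
      ≈⟨ -‿cong (solve 5 (λ a b c d e → (a :* b) :* (c :* (d :* e)) := d :* ((a :* c) :* (b :* e)))
           ≈-refl (ord x y) (ord-∏ y xs) (ord-∏ x xs) (sign p) (ε xs)) ⟩
    - (sign p * ((ord x y * ord-∏ x xs) * (ord-∏ y xs * ε xs)))
      ≈⟨ -‿distribˡ-* _ _ ⟩
    - sign p * ((ord x y * ord-∏ x xs) * (ord-∏ y xs * ε xs)) ∎
    where
    open ≈-Reasoning
    open R-Solver
  ε-alternating (trans p q) = ≈-trans (ε-alternating q)
    (≈-trans (*-congˡ (ε-alternating p)) (≈-trans (≈-sym (*-assoc _ _ _)) (*-congʳ (*-comm _ _))))

  ε-increasing : ∀ {n} {is : List (Fin n)} → AllPairs Fin._<_ is → ε is ≈ 1#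
  ε-increasing []         = ≈-refl
  ε-increasing (i< ∷ is<) = ≈-trans (*-cong (go i<) (ε-increasing is<)) (*-identityˡ 1#)
    where
    ord-< : ∀ {n} {i j : Fin n} → i Fin.< j → ord i j ≈ 1#
    ord-< {i = i} {j} i<j with Fin.<-cmp i j
    ... | tri< _ _ _   = ≈-refl
    ... | tri≈ i≮j _ _ = ⊥-elim (i≮j i<j)
    ... | tri> i≮j _ _ = ⊥-elim (i≮j i<j)
    go : ∀ {i js} → All (i Fin.<_) js → ord-∏ i js ≈ 1#
    go []         = ≈-refl
    go (i<j ∷ ps) = ≈-trans (*-cong (ord-< i<j) (go ps)) (*-identityˡ 1#)

  ε-allFin : ∀ n → ε (List.allFin n) ≈ 1#
  ε-allFin n = ε-increasing {n} (AllPairs.tabulate⁺-< {f = id} id)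

  -- For α = ε this is the determinant of the matrix formed by the listed rows of g.
  transform : ∀ {n} → (Fin n → Fin n → K) → (List (Fin n) → K) → List (Fin n) → K
  transform g α []           = α []
  transform {n} g α (i ∷ is) = ∑ (List.allFin n) (λ j → g i j * transform g (α ∘ (j ∷_)) is)

  -- Carries the sign from an exchange of the first two arguments of an alternating `α` past the
  -- sums over the remaining rows.
  transform-neg : ∀ {n} (g : Fin n → Fin n → K) {α β} → (∀ is → α is ≈ - β is) →
    ∀ is → transform g α is ≈ - transform g β is
  transform-neg g α≈-β [] = α≈-β []
  transform-neg {n} g {α} {β} α≈-β (i ∷ is) = begin
    ∑ (List.allFin n) (λ j → g i j * transform g (α ∘ (j ∷_)) is)
      ≈⟨ ∑-cong (List.allFin n) (λ j → ≈-trans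
           (*-congˡ (transform-neg g (λ js → α≈-β (j ∷ js)) is)) (term j)) ⟩
    ∑ (List.allFin n) (λ j → - 1# * (g i j * transform g (β ∘ (j ∷_)) is))
      ≈⟨ ∑-*ˡ (- 1#) (List.allFin n) _ ⟨
    - 1# * transform g β (i ∷ is)
      ≈⟨ -1*x≈-x _ ⟩
    - transform g β (i ∷ is) ∎
    where
    open ≈-Reasoning
    term : ∀ j → g i j * - transform g (β ∘ (j ∷_)) is ≈ - 1# * (g i j * transform g (β ∘ (j ∷_)) is)
    term j = ≈-trans (≈-sym (-‿distribʳ-* _ _)) (≈-sym (-1*x≈-x _))

  transform-alternating : ∀ {n} (g : Fin n → Fin n → K) {α} → Alternating α → Alternating (transform g α)
  transform-alternating g alt refl = ≈-sym (*-identityˡ _)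
  transform-alternating {n} g {α} alt (prep {xs} {ys} x p) = ≈-trans
    (∑-cong (List.allFin n) (λ j → ≈-trans
      (*-congˡ (transform-alternating g (alternating-∷ {α = α} j alt) p))
      (solve 3 (λ a b c → a :* (b :* c) := b :* (a :* c)) ≈-refl (g x j) (sign p) _)))
    (≈-sym (∑-*ˡ (sign p) (List.allFin n) _))
    where open R-Solver
  transform-alternating {n} g {α} alt (swap {xs} {ys} x y p) = begin
    ∑ N (λ j → g y j * ∑ N (λ i → g x i * transform g (α ∘ (j ∷_) ∘ (i ∷_)) ys))
      ≈⟨ ∑-cong N (λ j → ∑-*ˡ (g y j) N _) ⟩
    ∑ N (λ j → ∑ N (λ i → g y j * (g x i * transform g (α ∘ (j ∷_) ∘ (i ∷_)) ys)))
      ≈⟨ ∑-cong N (λ j → ∑-cong N (λ i → term i j)) ⟩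
    ∑ N (λ j → ∑ N (λ i → - sign p * (g x i * (g y j * transform g (α ∘ (i ∷_) ∘ (j ∷_)) xs))))
      -- The column indices of the two exchanged rows trade places here; the sign of this was taken
      -- from `α` in `term`.
      ≈⟨ ∑-swap N N _ ⟩
    ∑ N (λ i → ∑ N (λ j → - sign p * (g x i * (g y j * transform g (α ∘ (i ∷_) ∘ (j ∷_)) xs))))
      ≈⟨ ∑-cong N (λ i → ≈-trans (≈-sym (∑-*ˡ (- sign p) N _)) (*-congˡ (≈-sym (∑-*ˡ (g x i) N _)))) ⟩
    ∑ N (λ i → - sign p * (g x i * ∑ N (λ j → g y j * transform g (α ∘ (i ∷_) ∘ (j ∷_)) xs)))
      ≈⟨ ∑-*ˡ (- sign p) N _ ⟨
    - sign p * transform g α (x ∷ y ∷ xs) ∎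
    where
    open ≈-Reasoning
    N = List.allFin n
    swapped : ∀ i j → transform g (α ∘ (j ∷_) ∘ (i ∷_)) xs ≈ - transform g (α ∘ (i ∷_) ∘ (j ∷_)) xs
    swapped i j = transform-neg g (alternating-swap {α = α} alt i j) xs
    term : ∀ i j → g y j * (g x i * transform g (α ∘ (j ∷_) ∘ (i ∷_)) ys) ≈
      - sign p * (g x i * (g y j * transform g (α ∘ (i ∷_) ∘ (j ∷_)) xs))
    term i j = begin
      g y j * (g x i * transform g (α ∘ (j ∷_) ∘ (i ∷_)) ys)
        ≈⟨ *-congˡ (*-congˡ (≈-trans
             (transform-alternating g (alternating-∷ {α = α ∘ (j ∷_)} i (alternating-∷ {α = α} j alt)) p)
             (≈-trans (*-congˡ (swapped i j)) (≈-trans (≈-sym (-‿distribʳ-* _ _)) (-‿distribˡ-* _ _))))) ⟩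
      g y j * (g x i * (- sign p * transform g (α ∘ (i ∷_) ∘ (j ∷_)) xs))
        ≈⟨ solve 4 (λ a b c d → a :* (b :* (c :* d)) := c :* (b :* (a :* d))) ≈-refl (g y j) (g x i) (- sign p) _ ⟩
      - sign p * (g x i * (g y j * transform g (α ∘ (i ∷_) ∘ (j ∷_)) xs)) ∎
      where open R-Solver
  transform-alternating g alt (trans p q) = ≈-trans (transform-alternating g alt q)
    (≈-trans (*-congˡ (transform-alternating g alt p)) (≈-trans (≈-sym (*-assoc _ _ _)) (*-congʳ (*-comm _ _))))

  -- The recursion suits induction on a permutation of the rows, the single sum over words is the
  -- form in which determinants and Pfaffians arise.
  transform-∑ : ∀ {m n} (g : Fin n → Fin n → K) α (J : Vec (Fin n) m) →
    transform g α (toList J) ≈ ∑ (indices m n) (λ I → α (toList I) * ∏ (Vec.zipWith g J I))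
  transform-∑ g α [] = ≈-sym (≈-trans (+-identityʳ _) (*-identityʳ _))
  transform-∑ {suc m} {n} g α (j ∷ J) = ≈-sym (begin
    ∑ (indices (suc m) n) (λ I → α (toList I) * ∏ (Vec.zipWith g (j ∷ J) I))
      ≈⟨ ∑-tuples (List.allFin n) m _ ⟩
    ∑ (List.allFin n) (λ i → ∑ (indices m n) (λ I → α (i ∷ toList I) * (g j i * ∏ (Vec.zipWith g J I))))
      ≈⟨ ∑-cong (List.allFin n) (λ i → ≈-trans
           (∑-cong (indices m n) (λ I →
              solve 3 (λ a b c → a :* (b :* c) := b :* (a :* c)) ≈-refl (α (i ∷ toList I)) (g j i) _))
           (≈-trans (≈-sym (∑-*ˡ (g j i) (indices m n) _))
             (*-congˡ (≈-sym (transform-∑ g (α ∘ (i ∷_)) J))))) ⟩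
    ∑ (List.allFin n) (λ i → g j i * transform g (α ∘ (i ∷_)) (toList J)) ∎)
    where
    open ≈-Reasoning
    open R-Solver

  -- Leibniz's formula, extended to all words by the zeros of `ε`.
  det : ∀ {n} → (Fin n → Fin n → K) → K
  det {n} g = ∑ (indices n n) (λ I → ε (toList I) * ∏ (Vec.zipWith g (Vec.allFin n) I))

  toList-tabulate : ∀ {n} (f : Fin n → A) → toList (Vec.tabulate f) ≡ List.tabulate f
  toList-tabulate {n = zero}  f = ≡.refl
  toList-tabulate {n = suc n} f = ≡.cong (f zero ∷_) (toList-tabulate (f ∘ suc))

  toList-allFin : ∀ n → toList (Vec.allFin n) ≡ List.allFin n
  toList-allFin n = toList-tabulate id

  -- Alternating functions when 2 is invertible

  module Halving (½ : K) (½+½≈1 : ½ + ½ ≈ 1#) where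

    -- Exchanging the two equal letters gives `a = - a`, and half of `a + a` is `a`.
    alternating-repetition : ∀ {α : List A → K} → Alternating α → ∀ x xs → α (x ∷ x ∷ xs) ≈ 0#
    alternating-repetition {α = α} alt x xs = begin
      a                 ≈⟨ *-identityˡ a ⟨
      1# * a            ≈⟨ *-congʳ ½+½≈1 ⟨
      (½ + ½) * a       ≈⟨ solve 2 (λ h a → (h :+ h) :* a := h :* (a :+ a)) ≈-refl ½ a ⟩
      ½ * (a + a)       ≈⟨ *-congˡ (≈-trans (+-congʳ (alternating-swap {α = α} alt x x xs)) (-‿inverseˡ a)) ⟩
      ½ * 0#            ≈⟨ zeroʳ ½ ⟩
      0# ∎
      where
      a = α (x ∷ x ∷ xs)
      open ≈-Reasoning
      open R-Solver

    alternating-vanish : ∀ {α : List A → K} → Alternating α → ∀ {x xs ys} → ys ↭ x ∷ x ∷ xs → α ys ≈ 0#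
    alternating-vanish {α = α} alt {x} {xs} p = ≈-trans (alt (↭-sym p))
      (≈-trans (*-congˡ (alternating-repetition {α = α} alt x xs)) (zeroʳ _))

    -- Without repetitions, the word is reached from `allFin` by a derivation whose sign is `ε is`,
    -- since `ε` is itself alternating with value 1 at `allFin`. With a repetition, both sides
    -- vanish.
    alternating-determined : ∀ {n} {α : List (Fin n) → K} → Alternating α →
      ∀ is → length is ≡ n → α is ≈ ε is * α (List.allFin n)
    alternating-determined {n} {α} alt is len with unique-or-repetition Fin._≟_ is
    ... | inj₁ u = ≈-trans (alt p) (*-congʳ (≈-sym (≈-trans (ε-alternating p)
            (≈-trans (*-congˡ (ε-allFin n)) (*-identityʳ _)))))
      where p = Unique⇒allFin-↭ len u
    ... | inj₂ (_ , _ , p) = ≈-trans (alternating-vanish {α = α} alt p)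
            (≈-sym (≈-trans (*-congʳ (alternating-vanish ε-alternating p)) (zeroˡ _)))

    ε²≈1 : ∀ {n} {is : List (Fin n)} → length is ≡ n → Unique is → ε is * ε is ≈ 1#
    ε²≈1 {n} len u = ≈-trans (*-cong ε≈ ε≈) (sign² p)
      where
      p = Unique⇒allFin-↭ len u
      ε≈ = ≈-trans (ε-alternating p) (≈-trans (*-congˡ (ε-allFin n)) (*-identityʳ (sign p)))

    -- As a function of the row word `J` the sum is `transform g ε`, which is alternating. A
    -- repeated row is included, with both sides zero.
    det-rows : ∀ {n} (g : Fin n → Fin n → K) (J : Vec (Fin n) n) →
      ∑ (indices n n) (λ I → ε (toList I) * ∏ (Vec.zipWith g J I)) ≈ ε (toList J) * det g
    det-rows {n} g J = begin
      ∑ (indices n n) (λ I → ε (toList I) * ∏ (Vec.zipWith g J I))  ≈⟨ transform-∑ g ε J ⟨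
      transform g ε (toList J)
        ≈⟨ alternating-determined (transform-alternating g ε-alternating) (toList J) (Vec.length-toList J) ⟩
      ε (toList J) * transform g ε (List.allFin n)
        ≈⟨ *-congˡ (≡⇒≈ (≡.cong (transform g ε) (≡.sym (toList-allFin n)))) ⟩
      ε (toList J) * transform g ε (toList (Vec.allFin n))
        ≈⟨ *-congˡ (transform-∑ g ε (Vec.allFin n)) ⟩
      ε (toList J) * det g ∎
      where open ≈-Reasoning

  module OverRationals (ι : ℚ → K)
    (ι-+ : ∀ p q → ι (p ℚ.+ q) ≈ ι p + ι q)
    (ι-* : ∀ p q → ι (p ℚ.* q) ≈ ι p * ι q)
    (ι-neg : ∀ p → ι (ℚ.- p) ≈ - ι p)
    (ι-0 : ι 0ℚ ≈ 0#) (ι-1 : ι 1ℚ ≈ 1#) where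

    ½+½≈1 : ι ℚ.½ + ι ℚ.½ ≈ 1#
    ½+½≈1 = ≈-trans (≈-sym (ι-+ ℚ.½ ℚ.½)) ι-1

    open Halving (ι ℚ.½) ½+½≈1

    -- The Pfaffian and its invariance

    ∑-tuples-++ : ∀ (bs : List B) m {l} (f : Vec B (m ℕ.+ l) → K) →
      ∑ (tuples bs m) (λ I → ∑ (tuples bs l) (λ J → f (I Vec.++ J))) ≈ ∑ (tuples bs (m ℕ.+ l)) f
    ∑-tuples-++ bs zero    f = +-identityʳ _
    ∑-tuples-++ bs (suc m) f = ≈-trans (∑-tuples bs m _)
      (≈-trans (∑-cong bs (λ b → ∑-tuples-++ bs m (f ∘ (b ∷_)))) (≈-sym (∑-tuples bs _ f)))

    ∑-concat : ∀ (bs : List B) m d (f : Vec B (d ℕ.* m) → K) →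
      ∑ (tuples (tuples bs m) d) (f ∘ concat) ≈ ∑ (tuples bs (d ℕ.* m)) f
    ∑-concat bs m zero    f = ≈-refl
    ∑-concat bs m (suc d) f = ≈-trans (∑-tuples (tuples bs m) d _)
      (≈-trans (∑-cong (tuples bs m) (λ I → ∑-concat bs m d (f ∘ (I Vec.++_)))) (∑-tuples-++ bs m f))

    Pf : ∀ m d → (Vec (Fin (d ℕ.* m)) m → K) → K
    Pf m d w = ∑ (tuples (indices m (d ℕ.* m)) d) (λ Js → ε (toList (concat Js)) * ∏ (Vec.map w Js))

    Pf-act : ∀ m d g w → Pf m d (act g w) ≈ det g * Pf m d w
    Pf-act m d g w = begin
      ∑ T (λ Is → ε (toList (concat Is)) * ∏ (Vec.map (act g w) Is))
        ≈⟨ ∑-cong T (λ Is → ≈-trans (*-congˡ (monomial-act g w Is)) (∑-*ˡ (ε (toList (concat Is))) T _)) ⟩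
      ∑ T (λ Is → ∑ T (λ Js → ε (toList (concat Is)) * (∏ (Vec.map w Js) * ∏ (Vec.zipWith g (concat Js) (concat Is)))))
        ≈⟨ ∑-swap T T _ ⟩
      ∑ T (λ Js → ∑ T (λ Is → ε (toList (concat Is)) * (∏ (Vec.map w Js) * ∏ (Vec.zipWith g (concat Js) (concat Is)))))
        ≈⟨ ∑-cong T (λ Js → ∑-cong T (λ Is →
             solve 3 (λ a b c → a :* (b :* c) := b :* (a :* c)) ≈-refl (ε (toList (concat Is))) (∏ (Vec.map w Js)) _)) ⟩
      ∑ T (λ Js → ∑ T (λ Is → ∏ (Vec.map w Js) * (ε (toList (concat Is)) * ∏ (Vec.zipWith g (concat Js) (concat Is)))))
        ≈⟨ ∑-cong T (λ Js → ≈-sym (∑-*ˡ (∏ (Vec.map w Js)) T _)) ⟩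
      ∑ T (λ Js → ∏ (Vec.map w Js) * ∑ T (λ Is → ε (toList (concat Is)) * ∏ (Vec.zipWith g (concat Js) (concat Is))))
        -- For fixed `Js`, a sum over tuples of blocks is a sum over words of length `n`, hence the
        -- determinant with rows `concat Js`.
        ≈⟨ ∑-cong T (λ Js → *-congˡ (≈-trans
             (∑-concat (List.allFin n) m d (λ I → ε (toList I) * ∏ (Vec.zipWith g (concat Js) I)))
             (det-rows g (concat Js)))) ⟩
      ∑ T (λ Js → ∏ (Vec.map w Js) * (ε (toList (concat Js)) * det g))
        ≈⟨ ∑-cong T (λ Js → solve 3 (λ a b c → a :* (b :* c) := c :* (b :* a)) ≈-refl (∏ (Vec.map w Js)) _ (det g)) ⟩
      ∑ T (λ Js → det g * (ε (toList (concat Js)) * ∏ (Vec.map w Js)))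
        ≈⟨ ∑-*ˡ (det g) T _ ⟨
      det g * Pf m d w ∎
      where
      open ≈-Reasoning
      open R-Solver
      n = d ℕ.* m
      T = tuples (indices m n) d

    -- Permutations of blocks of even length

    -1^ : ℕ → K
    -1^ zero    = 1#
    -1^ (suc n) = - -1^ n

    -1^-+ : ∀ m n → -1^ (m ℕ.+ n) ≈ -1^ m * -1^ n
    -1^-+ zero    n = ≈-sym (*-identityˡ _)
    -1^-+ (suc m) n = ≈-trans (-‿cong (-1^-+ m n)) (-‿distribˡ-* _ _)

    -1^-double : ∀ k → -1^ (2 ℕ.* k) ≈ 1#
    -1^-double k = ≈-trans (≡⇒≈ (≡.cong (λ l → -1^ (k ℕ.+ l)) (ℕ.+-identityʳ k))) (≈-trans (-1^-+ k k) (square k))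
      where
      square : ∀ k → -1^ k * -1^ k ≈ 1#
      square zero    = *-identityˡ 1#
      square (suc k) = ≈-trans (-x*-y≈x*y _ _) (square k)

    move : ∀ (x : A) ys zs → Σ[ p ∈ x ∷ (ys List.++ zs) ↭ ys List.++ (x ∷ zs) ] sign p ≈ -1^ (length ys)
    move x []       zs = refl , ≈-refl
    move x (y ∷ ys) zs with move x ys zs
    ... | p , sign-p = trans (swap x y refl) (prep y p) , ≈-trans (-1*x≈-x (sign p)) (-‿cong sign-p)

    -- Each letter of `xs` crosses all of `ys`, at the cost of one sign per letter of `ys`. Evenness
    -- of this one block is enough.
    swap-even : ∀ (xs ys zs : List A) → -1^ (length ys) ≈ 1# →
      Σ[ p ∈ xs List.++ (ys List.++ zs) ↭ ys List.++ (xs List.++ zs) ] sign p ≈ 1#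
    swap-even []       ys zs even = refl , ≈-refl
    swap-even (x ∷ xs) ys zs even with swap-even xs ys zs even | move x ys (xs List.++ zs)
    ... | p , sign-p | q , sign-q = trans (prep x p) q ,
      ≈-trans (*-cong sign-p (≈-trans sign-q even)) (*-identityˡ 1#)

    sign-++⁺ˡ : ∀ (xs : List A) {ys zs} (p : ys ↭ zs) → sign (↭.++⁺ˡ xs p) ≈ sign p
    sign-++⁺ˡ []       p = ≈-refl
    sign-++⁺ˡ (x ∷ xs) p = sign-++⁺ˡ xs p

    flatten : ∀ {m} → List (Vec A m) → List A
    flatten = List.concatMap toList

    -- A derivation on blocks is refined to one on letters; every exchange of two blocks is even by
    -- `swap-even`.
    flatten-even : ∀ {m} → -1^ m ≈ 1# → {Is Js : List (Vec A m)} → Is ↭ Js →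
      Σ[ p ∈ flatten Is ↭ flatten Js ] sign p ≈ 1#
    flatten-even even refl = refl , ≈-refl
    flatten-even even (prep I p) with flatten-even even p
    ... | q , sign-q = ↭.++⁺ˡ (toList I) q , ≈-trans (sign-++⁺ˡ (toList I) q) sign-q
    flatten-even even (swap {Is} I J p)
      with flatten-even even p | swap-even (toList I) (toList J) (flatten Is)
                                   (≈-trans (≡⇒≈ (≡.cong -1^ (Vec.length-toList J))) even)
    ... | q , sign-q | r , sign-r =
      trans r (↭.++⁺ˡ (toList J) (↭.++⁺ˡ (toList I) q)) ,
      ≈-trans (*-cong sign-r (≈-trans (sign-++⁺ˡ (toList J) (↭.++⁺ˡ (toList I) q))
        (≈-trans (sign-++⁺ˡ (toList I) q) sign-q))) (*-identityˡ 1#)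
    flatten-even even (trans p q) with flatten-even even p | flatten-even even q
    ... | p′ , sign-p | q′ , sign-q = trans p′ q′ , ≈-trans (*-cong sign-p sign-q) (*-identityˡ 1#)

    toList-concat : ∀ {m d} (Js : Vec (Vec A m) d) → toList (concat Js) ≡ flatten (toList Js)
    toList-concat []       = ≡.refl
    toList-concat (J ∷ Js) = ≡.trans (Vec.toList-++ J (concat Js)) (≡.cong (toList J List.++_) (toList-concat Js))

    ε-blocks : ∀ {m n d} → -1^ m ≈ 1# → (Is Js : Vec (Vec (Fin n) m) d) → toList Is ↭ toList Js →
      ε (toList (concat Js)) ≈ ε (toList (concat Is))
    ε-blocks even Is Js p with flatten-even even p
    ... | q , sign-q = ≈-trans (≡⇒≈ (≡.cong ε (toList-concat Js)))
      (≈-trans (ε-alternating q) (≈-trans (*-congʳ sign-q) (≈-trans (*-identityˡ _)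
        (≡⇒≈ (≡.cong ε (≡.sym (toList-concat Is)))))))

    map-lookup-allFin : ∀ {n} (xs : Vec A n) → List.map (Vec.lookup xs) (List.allFin n) ≡ toList xs
    map-lookup-allFin xs = ≡.trans (List.map-tabulate id (Vec.lookup xs))
      (≡.trans (≡.sym (toList-tabulate (Vec.lookup xs))) (≡.cong toList (Vec.tabulate∘lookup xs)))

    permuteFactors-↭ : ∀ {d} (σ : Permutation′ d) (xs : Vec A d) → toList xs ↭ toList (permuteFactors σ xs)
    permuteFactors-↭ {d = d} σ xs = ≡.subst₂ _↭_ (map-lookup-allFin xs) right
      (↭.map⁺ (Vec.lookup xs) (Unique⇒allFin-↭ (List.length-tabulate (σ ⟨$⟩ʳ_)) (Unique.tabulate⁺ injective)))
      where
      injective : ∀ {i j} → σ ⟨$⟩ʳ i ≡ σ ⟨$⟩ʳ j → i ≡ j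
      injective eq = ≡.trans (≡.sym (inverseˡ σ)) (≡.trans (≡.cong (σ ⟨$⟩ˡ_) eq) (inverseˡ σ))
      right : List.map (Vec.lookup xs) (List.tabulate (σ ⟨$⟩ʳ_)) ≡ toList (permuteFactors σ xs)
      right = ≡.trans (List.map-tabulate (σ ⟨$⟩ʳ_) (Vec.lookup xs)) (≡.sym (toList-tabulate _))

    -- Nonvanishing

    -- The ring carries no order. A sum of zeros and ones has a rational value, and its positivity
    -- is recorded there.
    ZeroOne : K → Set
    ZeroOne x = x ≈ 0# ⊎ x ≈ 1#

    p≤1+p : ∀ p → p ℚ.≤ 1ℚ ℚ.+ p
    p≤1+p p = ℚ.≤-trans (ℚ.≤-reflexive (≡.sym (ℚ.+-identityˡ p))) (ℚ.+-monoˡ-≤ p (ℚ.nonNegative⁻¹ 1ℚ))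

    ∑-ZeroOne≥0 : ∀ (xs : List A) {f} → (∀ x → ZeroOne (f x)) → ∃ λ q → 0ℚ ℚ.≤ q × ∑ xs f ≈ ι q
    ∑-ZeroOne≥0 []       zo = 0ℚ , ℚ.≤-refl , ≈-sym ι-0
    ∑-ZeroOne≥0 (x ∷ xs) zo with ∑-ZeroOne≥0 xs zo | zo x
    ... | q , q≥0 , ∑≈ | inj₁ ≈0 = q , q≥0 , ≈-trans (+-cong ≈0 ∑≈) (+-identityˡ _)
    ... | q , q≥0 , ∑≈ | inj₂ ≈1 = 1ℚ ℚ.+ q , ℚ.≤-trans q≥0 (p≤1+p q)
      , ≈-trans (+-cong (≈-trans ≈1 (≈-sym ι-1)) ∑≈) (≈-sym (ι-+ 1ℚ q))

    ∑-ZeroOne≥1 : ∀ {xs : List A} {x f} → (∀ x → ZeroOne (f x)) → x ∈ xs → f x ≈ 1# →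
      ∃ λ q → 1ℚ ℚ.≤ q × ∑ xs f ≈ ι q
    ∑-ZeroOne≥1 {xs = x ∷ xs} zo (here ≡.refl) fx≈1 with ∑-ZeroOne≥0 xs zo
    ... | q , q≥0 , ∑≈ = 1ℚ ℚ.+ q , ℚ.≤-trans (ℚ.≤-reflexive (≡.sym (ℚ.+-identityʳ 1ℚ))) (ℚ.+-monoʳ-≤ 1ℚ q≥0)
      , ≈-trans (+-cong (≈-trans fx≈1 (≈-sym ι-1)) ∑≈) (≈-sym (ι-+ 1ℚ q))
    ∑-ZeroOne≥1 {xs = y ∷ xs} zo (there x∈xs) fx≈1 with ∑-ZeroOne≥1 zo x∈xs fx≈1 | zo y
    ... | q , q≥1 , ∑≈ | inj₁ ≈0 = q , q≥1 , ≈-trans (+-cong ≈0 ∑≈) (+-identityˡ _)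
    ... | q , q≥1 , ∑≈ | inj₂ ≈1 = 1ℚ ℚ.+ q , ℚ.≤-trans q≥1 (p≤1+p q)
      , ≈-trans (+-cong (≈-trans ≈1 (≈-sym ι-1)) ∑≈) (≈-sym (ι-+ 1ℚ q))

    ∈-tuples : ∀ {bs : List B} {d} (t : Vec B d) → (∀ b → b ∈ bs) → t ∈ tuples bs d
    ∈-tuples []      all∈ = here ≡.refl
    ∈-tuples (b ∷ t) all∈ = ∈-cartesianProductWith⁺ _∷_ (all∈ b) (∈-tuples t all∈)

    ∈-flatten : ∀ {m} {x : A} {J : Vec A m} {Js} → J ∈ Js → x ∈ toList J → x ∈ flatten Js
    ∈-flatten (here ≡.refl)       x∈J = ∈-++⁺ˡ x∈J
    ∈-flatten {Js = I ∷ _} (there J∈) x∈J = ∈-++⁺ʳ (toList I) (∈-flatten J∈ x∈J)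

    Unique-++⁻ʳ : ∀ (xs : List A) {ys} → Unique (xs List.++ ys) → Unique ys
    Unique-++⁻ʳ []       u       = u
    Unique-++⁻ʳ (x ∷ xs) (_ ∷ u) = Unique-++⁻ʳ xs u

    -- A repeated block would repeat its first letter; hence the blocks have length `suc m`.
    Unique-flatten⁻ : ∀ {m} (Js : List (Vec A (suc m))) → Unique (flatten Js) → Unique Js
    Unique-flatten⁻ []             _         = []
    Unique-flatten⁻ ((j ∷ J) ∷ Js) (j# ∷ u) =
      ¬Any⇒All¬ Js (λ J∈Js → All.lookup (++⁻ʳ (toList J) j#) (∈-flatten J∈Js (here ≡.refl)) ≡.refl)
      ∷ Unique-flatten⁻ Js (Unique-++⁻ʳ (toList J) u)

    module _ {m d : ℕ} (even : -1^ (suc m) ≈ 1#) where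
      private
        n = d ℕ.* suc m
        Bs : Vec (Vec (Fin n) (suc m)) d
        Bs = proj₁ (Vec.group d (suc m) (Vec.allFin n))

        concat-Bs : toList (concat Bs) ≡ List.allFin n
        concat-Bs = ≡.trans (≡.cong toList (≡.sym (proj₂ (Vec.group d (suc m) (Vec.allFin n))))) (toList-allFin n)

        open DecMembership (Vec.≡-dec {n = suc m} (Fin._≟_ {n})) using (_∈?_)

      -- The sum of the basis tensors e₁ ⊗ ⋯ ⊗ eₘ, eₘ₊₁ ⊗ ⋯ ⊗ e₂ₘ, ….
      blockSum : Vec (Fin n) (suc m) → K
      blockSum J with J ∈? toList Bs
      ... | yes _ = 1#
      ... | no  _ = 0#

      private
        blockSum-∈ : ∀ {J} → J ∈ toList Bs → blockSum J ≈ 1#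
        blockSum-∈ {J} J∈ with J ∈? toList Bs
        ... | yes _ = ≈-refl
        ... | no J∉ = ⊥-elim (J∉ J∈)

        monomial : ∀ {k} (Js : Vec (Vec (Fin n) (suc m)) k) →
          ∏ (Vec.map blockSum Js) ≈ 0# ⊎ (∏ (Vec.map blockSum Js) ≈ 1# × All (_∈ toList Bs) (toList Js))
        monomial [] = inj₂ (≈-refl , [])
        monomial (J ∷ Js) with J ∈? toList Bs | monomial Js
        ... | no _  | _ = inj₁ (zeroˡ _)
        ... | yes _ | inj₁ ≈0 = inj₁ (≈-trans (*-identityˡ _) ≈0)
        ... | yes J∈ | inj₂ (≈1 , Js⊆) = inj₂ (≈-trans (*-identityˡ _) ≈1 , J∈ ∷ Js⊆)

        -- If the term survives, its letters are distinct, so its blocks are `d` distinct members of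
        -- `Bs`. They are then a rearrangement of `Bs`, and the even block length makes `ε` equal to
        -- its value 1 on the identity word.
        term : ∀ Js → ZeroOne (ε (toList (concat Js)) * ∏ (Vec.map blockSum Js))
        term Js with unique-or-repetition Fin._≟_ (toList (concat Js)) | monomial Js
        ... | inj₂ (_ , _ , p) | _ = inj₁ (≈-trans (*-congʳ (alternating-vanish ε-alternating p)) (zeroˡ _))
        ... | inj₁ _ | inj₁ ≈0 = inj₁ (≈-trans (*-congˡ ≈0) (zeroʳ _))
        ... | inj₁ u | inj₂ (≈1 , Js⊆) = inj₂ (≈-trans (*-cong ε≈1 ≈1) (*-identityˡ 1#))
          where
          Js↭Bs : toList Js ↭ toList Bs
          Js↭Bs = Unique-⊆⇒↭ (Unique-flatten⁻ (toList Js) (≡.subst Unique (toList-concat Js) u)) (All.lookup Js⊆)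
            (ℕ.≤-reflexive (≡.trans (Vec.length-toList Bs) (≡.sym (Vec.length-toList Js))))
          ε≈1 : ε (toList (concat Js)) ≈ 1#
          ε≈1 = ≈-trans (ε-blocks even Bs Js (↭-sym Js↭Bs)) (≈-trans (≡⇒≈ (≡.cong ε concat-Bs)) (ε-allFin n))

        ∏≈1 : ∀ {k} (Js : Vec (Vec (Fin n) (suc m)) k) → All (_∈ toList Bs) (toList Js) →
          ∏ (Vec.map blockSum Js) ≈ 1#
        ∏≈1 []       []         = ≈-refl
        ∏≈1 (J ∷ Js) (J∈ ∷ Js⊆) = ≈-trans (*-cong (blockSum-∈ J∈) (∏≈1 Js Js⊆)) (*-identityˡ 1#)

      Pf-blockSum : ∃ λ q → 1ℚ ℚ.≤ q × Pf (suc m) d blockSum ≈ ι q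
      Pf-blockSum = ∑-ZeroOne≥1 term (∈-tuples Bs (λ J → ∈-tuples J ∈-allFin))
        (≈-trans (*-cong (≈-trans (≡⇒≈ (≡.cong ε concat-Bs)) (ε-allFin n)) (∏≈1 Bs (All.tabulate id)))
          (*-identityˡ 1#))

    -- Monomial matrices

    -- Column `i` has the single entry `s i`, in row `τ i`. Torus elements and signed permutations
    -- are both of this kind, and both send a monomial to a multiple of a monomial.
    monomialMatrix : ∀ {n} → (Fin n → Fin n) → (Fin n → K) → Fin n → Fin n → K
    monomialMatrix τ s j i = s i * e j (τ i)

    ∏-zipWith-mapʳ : ∀ {C : Set} {n} (f : A → C → K) (h : B → C) (xs : Vec A n) (ys : Vec B n) →
      ∏ (Vec.zipWith (λ x y → f x (h y)) xs ys) ≈ ∏ (Vec.zipWith f xs (Vec.map h ys))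
    ∏-zipWith-mapʳ f h []       []       = ≈-refl
    ∏-zipWith-mapʳ f h (x ∷ xs) (y ∷ ys) = *-congˡ (∏-zipWith-mapʳ f h xs ys)

    ∏-monomialMatrix : ∀ {m n} τ s (J I : Vec (Fin n) m) →
      ∏ (Vec.zipWith (monomialMatrix τ s) J I) ≈ ∏ (Vec.map s I) * ∏ (Vec.zipWith e J (Vec.map τ I))
    ∏-monomialMatrix τ s J I = ≈-trans (∏-zipWith-*ʳ J I s (λ j i → e j (τ i)))
      (*-congˡ (∏-zipWith-mapʳ e τ J I))

    act-monomialMatrix : ∀ {m n} τ s (w : Vec (Fin n) m → K) I →
      act (monomialMatrix τ s) w I ≈ w (Vec.map τ I) * ∏ (Vec.map s I)
    act-monomialMatrix {m} {n} τ s w I = begin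
      ∑ N (λ J → w J * ∏ (Vec.zipWith (monomialMatrix τ s) J I))
        ≈⟨ ∑-cong N (λ J → ≈-trans (*-congˡ (∏-monomialMatrix τ s J I))
             (solve 3 (λ a b c → a :* (b :* c) := b :* (a :* c)) ≈-refl (w J) (∏ (Vec.map s I)) _)) ⟩
      ∑ N (λ J → ∏ (Vec.map s I) * (w J * ∏ (Vec.zipWith e J (Vec.map τ I))))
        ≈⟨ ∑-*ˡ _ N _ ⟨
      ∏ (Vec.map s I) * ∑ N (λ J → w J * ∏ (Vec.zipWith e J (Vec.map τ I)))
        ≈⟨ *-congˡ (∑-δ w (Vec.map τ I)) ⟩
      ∏ (Vec.map s I) * w (Vec.map τ I)
        ≈⟨ *-comm _ _ ⟩
      w (Vec.map τ I) * ∏ (Vec.map s I) ∎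
      where
      open ≈-Reasoning
      open R-Solver
      N = indices m n

    monomial-monomialMatrix : ∀ {m n d} τ s (w : Vec (Fin n) m → K) (Is : Vec (Vec (Fin n) m) d) →
      ∏ (Vec.map (act (monomialMatrix τ s) w) Is) ≈
      ∏ (Vec.map w (Vec.map (Vec.map τ) Is)) * ∏ (Vec.map s (concat Is))
    monomial-monomialMatrix τ s w Is = begin
      ∏ (Vec.map (act (monomialMatrix τ s) w) Is)
        ≈⟨ ∏-cong Is (act-monomialMatrix τ s w) ⟩
      ∏ (Vec.map (λ I → w (Vec.map τ I) * ∏ (Vec.map s I)) Is)
        ≈⟨ ∏-map-* Is _ _ ⟩
      ∏ (Vec.map (λ I → w (Vec.map τ I)) Is) * ∏ (Vec.map (λ I → ∏ (Vec.map s I)) Is)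
        ≈⟨ *-cong (≡⇒≈ (≡.cong ∏ (Vec.map-∘ w (Vec.map τ) Is))) (∏-map-concat s Is) ⟩
      ∏ (Vec.map w (Vec.map (Vec.map τ) Is)) * ∏ (Vec.map s (concat Is)) ∎
      where open ≈-Reasoning

    e-injective : ∀ {n} (τ : Fin n → Fin n) → (∀ {i j} → τ i ≡ τ j → i ≡ j) → ∀ i j → e (τ i) (τ j) ≈ e j i
    e-injective τ inj i j with i Fin.≟ j
    ... | yes ≡.refl = ≈-trans (e-diag (τ i)) (≈-sym (e-diag i))
    ... | no i≢j    = ≈-trans (e-off (i≢j ∘ inj)) (≈-sym (e-off (i≢j ∘ ≡.sym)))

    -- Taking the rows in the order given by `τ` makes the matrix diagonal, so only the identity
    -- word contributes to `det-rows`.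
    det-monomialMatrix : ∀ {n} τ s → (∀ {i j : Fin n} → τ i ≡ τ j → i ≡ j) →
      ε (toList (Vec.map τ (Vec.allFin n))) * det (monomialMatrix τ s) ≈ ∏ (Vec.map s (Vec.allFin n))
    det-monomialMatrix {n} τ s inj = begin
      ε (toList (Vec.map τ id-n)) * det (monomialMatrix τ s)
        ≈⟨ det-rows (monomialMatrix τ s) (Vec.map τ id-n) ⟨
      ∑ N (λ I → ε (toList I) * ∏ (Vec.zipWith (monomialMatrix τ s) (Vec.map τ id-n) I))
        ≈⟨ ∑-cong N (λ I → *-congˡ (≈-trans
             (∏-zipWith-*ʳ (Vec.map τ id-n) I s (λ j i → e j (τ i))) (*-congˡ (entries id-n I)))) ⟩
      ∑ N (λ I → ε (toList I) * (∏ (Vec.map s I) * ∏ (Vec.zipWith e I id-n)))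
        ≈⟨ ∑-cong N (λ I → ≈-sym (*-assoc _ _ _)) ⟩
      ∑ N (λ I → ε (toList I) * ∏ (Vec.map s I) * ∏ (Vec.zipWith e I id-n))
        ≈⟨ ∑-δ (λ I → ε (toList I) * ∏ (Vec.map s I)) id-n ⟩
      ε (toList id-n) * ∏ (Vec.map s id-n)
        ≈⟨ *-congʳ (≈-trans (≡⇒≈ (≡.cong ε (toList-allFin n))) (ε-allFin n)) ⟩
      1# * ∏ (Vec.map s id-n)
        ≈⟨ *-identityˡ _ ⟩
      ∏ (Vec.map s id-n) ∎
      where
      open ≈-Reasoning
      N = indices n n
      id-n = Vec.allFin n
      entries : ∀ {k} (J I : Vec (Fin n) k) →
        ∏ (Vec.zipWith (λ j i → e j (τ i)) (Vec.map τ J) I) ≈ ∏ (Vec.zipWith e I J)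
      entries []      []      = ≈-refl
      entries (j ∷ J) (i ∷ I) = *-cong (e-injective τ inj j i) (entries J I)

    diagonal : ∀ {n} → (Fin n → K) → Fin n → Fin n → K
    diagonal = monomialMatrix id

    det-diagonal : ∀ {n} (s : Fin n → K) → det (diagonal s) ≈ ∏ (Vec.map s (Vec.allFin n))
    det-diagonal {n} s = ≈-trans (≈-sym (*-identityˡ _)) (≈-trans (*-congʳ (≈-sym ε≈1)) (det-monomialMatrix id s id))
      where
      ε≈1 : ε (toList (Vec.map id (Vec.allFin n))) ≈ 1#
      ε≈1 = ≈-trans
        (≡⇒≈ (≡.cong ε (≡.trans (≡.cong toList (Vec.map-id (Vec.allFin n))) (toList-allFin n))))
        (ε-allFin n)

    monomial-diagonal : ∀ {m n d} s (w : Vec (Fin n) m → K) (Is : Vec (Vec (Fin n) m) d) →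
      ∏ (Vec.map (act (diagonal s) w) Is) ≈ ∏ (Vec.map s (concat Is)) * ∏ (Vec.map w Is)
    monomial-diagonal s w Is = ≈-trans (monomial-monomialMatrix id s w Is)
      (≈-trans (*-comm _ _) (*-congˡ (≡⇒≈ (≡.cong (∏ ∘ Vec.map w)
        (≡.trans (Vec.map-cong Vec.map-id Is) (Vec.map-id Is))))))

    -- Weights of words under the torus

    ∏L : List K → K
    ∏L = List.foldr _*_ 1#

    ∏-map-toList : ∀ {n} (f : A → K) (xs : Vec A n) → ∏ (Vec.map f xs) ≡ ∏L (List.map f (toList xs))
    ∏-map-toList f []       = ≡.refl
    ∏-map-toList f (x ∷ xs) = ≡.cong (f x *_) (∏-map-toList f xs)

    spike : ∀ {n} → K → Fin n → Fin n → K
    spike c i j with i Fin.≟ j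
    ... | yes _ = c
    ... | no  _ = 1#

    spike-diag : ∀ {n} c (i : Fin n) → spike c i i ≈ c
    spike-diag c i with i Fin.≟ i
    ... | yes _  = ≈-refl
    ... | no i≢i = ⊥-elim (i≢i ≡.refl)

    spike-off : ∀ {n} c {i j : Fin n} → i ≢ j → spike c i j ≈ 1#
    spike-off c {i} {j} i≢j with i Fin.≟ j
    ... | yes i≡j = ⊥-elim (i≢j i≡j)
    ... | no _    = ≈-refl

    ∏-spike-∉ : ∀ {n} c {i : Fin n} {is} → i ∉ is → ∏L (List.map (spike c i) is) ≈ 1#
    ∏-spike-∉ c {is = []}     i∉ = ≈-refl
    ∏-spike-∉ c {is = j ∷ is} i∉ = ≈-trans
      (*-cong (spike-off c (i∉ ∘ here)) (∏-spike-∉ c (i∉ ∘ there))) (*-identityˡ 1#)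

    ∏-spike-∈ : ∀ {n} c {i : Fin n} {is} → Unique is → i ∈ is → ∏L (List.map (spike c i) is) ≈ c
    ∏-spike-∈ c {i} (i# ∷ u) (here ≡.refl) = ≈-trans
      (*-cong (spike-diag c i) (∏-spike-∉ c (λ i∈ → All.lookup i# i∈ ≡.refl))) (*-identityʳ c)
    ∏-spike-∈ c (j# ∷ u) (there i∈) = ≈-trans
      (*-cong (spike-off c (λ i≡j → All.lookup j# i∈ (≡.sym i≡j))) (∏-spike-∈ c u i∈)) (*-identityˡ c)

    2ℚ : ℚ
    2ℚ = 1ℚ ℚ.+ 1ℚ

    1≤2* : ∀ {q} → 1ℚ ℚ.≤ q → 2ℚ ℚ.≤ 2ℚ ℚ.* q
    1≤2* {q} 1≤q = ℚ.≤-trans (ℚ.≤-reflexive (≡.sym (ℚ.*-identityʳ 2ℚ))) (ℚ.*-monoˡ-≤-nonNeg 2ℚ 1≤q)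

    1≤2 : 1ℚ ℚ.≤ 2ℚ
    1≤2 = ℚ.≤-trans (ℚ.≤-reflexive (≡.sym (ℚ.+-identityʳ 1ℚ))) (ℚ.+-monoʳ-≤ 1ℚ (ℚ.nonNegative⁻¹ 1ℚ))

    ∏-spike-2 : ∀ {n} (i : Fin n) is → ∃ λ q → 1ℚ ℚ.≤ q × ∏L (List.map (spike (ι 2ℚ) i) is) ≈ ι q
    ∏-spike-2 i [] = 1ℚ , ℚ.≤-refl , ≈-sym ι-1
    ∏-spike-2 i (j ∷ is) with i Fin.≟ j | ∏-spike-2 i is
    ... | yes _ | q , 1≤q , ∏≈ = 2ℚ ℚ.* q , ℚ.≤-trans 1≤2 (1≤2* 1≤q) , ≈-trans (*-congˡ ∏≈) (≈-sym (ι-* 2ℚ q))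
    ... | no _  | q , 1≤q , ∏≈ = q , 1≤q , ≈-trans (*-identityˡ _) ∏≈

    -- Invariants only involve monomials of weight zero

    -- A constructive form of nonzero weight: a torus element of determinant 1 together with an
    -- inverse of 1 minus its eigenvalue on the word.
    Unbalanced : ∀ {n} → List (Fin n) → Set
    Unbalanced {n} is = Σ[ s ∈ (Fin n → K) ] ∏ (Vec.map s (Vec.allFin n)) ≈ 1# ×
      ∃ λ c → c * (1# + - ∏L (List.map s is)) ≈ 1#

    ι-inverse : ∀ {q} → 2ℚ ℚ.≤ q → ∃ λ c → c * (1# + - ι q) ≈ 1#
    ι-inverse {q} 2≤q = ι (ℚ.1/ r) , (begin
      ι (ℚ.1/ r) * (1# + - ι q)   ≈⟨ *-congˡ (≈-sym (≈-trans (ι-+ 1ℚ (ℚ.- q)) (+-cong ι-1 (ι-neg q)))) ⟩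
      ι (ℚ.1/ r) * ι r            ≈⟨ ι-* (ℚ.1/ r) r ⟨
      ι (ℚ.1/ r ℚ.* r)            ≈⟨ ≡⇒≈ (≡.cong ι (ℚ.*-inverseˡ r)) ⟩
      ι 1ℚ                        ≈⟨ ι-1 ⟩
      1#                          ∎)
      where
      open ≈-Reasoning
      r = 1ℚ ℚ.- q
      r<0 : r ℚ.< 0ℚ
      r<0 = ℚ.≤-<-trans (ℚ.+-monoʳ-≤ 1ℚ (ℚ.neg-antimono-≤ 2≤q)) (ℚ.negative⁻¹ (1ℚ ℚ.- 2ℚ))
      instance
        r≢0 : ℚ.NonZero r
        r≢0 = ℚ.neg⇒nonZero r {{ℚ.negative r<0}}

    missing⇒unbalanced : ∀ {n} {i j : Fin n} {is} → j ∉ i ∷ is → Unbalanced (i ∷ is)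
    missing⇒unbalanced {n} {i} {j} {is} j∉ = s , ∏s≈1 , c , ≈-trans (*-congˡ (+-congˡ (-‿cong eigenvalue))) c-inverse
      where
      s : Fin n → K
      s x = spike (ι 2ℚ) i x * spike (ι ℚ.½) j x
      ∏L-* : ∀ (xs : List (Fin n)) →
        ∏L (List.map s xs) ≈ ∏L (List.map (spike (ι 2ℚ) i) xs) * ∏L (List.map (spike (ι ℚ.½) j) xs)
      ∏L-* []       = ≈-sym (*-identityˡ 1#)
      ∏L-* (x ∷ xs) = ≈-trans (*-congˡ (∏L-* xs))
        (solve 4 (λ a b c d → (a :* b) :* (c :* d) := (a :* c) :* (b :* d)) ≈-refl _ _ _ _)
        where open R-Solver
      ∏s≈1 : ∏ (Vec.map s (Vec.allFin n)) ≈ 1#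
      ∏s≈1 = begin
        ∏ (Vec.map s (Vec.allFin n))
          ≈⟨ ≡⇒≈ (≡.trans (∏-map-toList s (Vec.allFin n)) (≡.cong (∏L ∘ List.map s) (toList-allFin n))) ⟩
        ∏L (List.map s (List.allFin n))
          ≈⟨ ∏L-* (List.allFin n) ⟩
        ∏L (List.map (spike (ι 2ℚ) i) (List.allFin n)) * ∏L (List.map (spike (ι ℚ.½) j) (List.allFin n))
          ≈⟨ *-cong (∏-spike-∈ (ι 2ℚ) (Unique.allFin⁺ n) (∈-allFin i))
                    (∏-spike-∈ (ι ℚ.½) (Unique.allFin⁺ n) (∈-allFin j)) ⟩
        ι 2ℚ * ι ℚ.½
          ≈⟨ ι-* 2ℚ ℚ.½ ⟨
        ι 1ℚ
          ≈⟨ ι-1 ⟩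
        1# ∎
        where open ≈-Reasoning
      q′ = proj₁ (∏-spike-2 i is)
      c,p = ι-inverse (1≤2* (proj₁ (proj₂ (∏-spike-2 i is))))
      c = proj₁ c,p
      c-inverse = proj₂ c,p
      -- The head alone contributes 2, further occurrences of `i` contribute `q′ ≥ 1`, and the entry
      -- 1/2 is never met because `j` is missing.
      eigenvalue : ∏L (List.map s (i ∷ is)) ≈ ι (2ℚ ℚ.* q′)
      eigenvalue = begin
        ∏L (List.map s (i ∷ is))
          ≈⟨ ∏L-* (i ∷ is) ⟩
        ∏L (List.map (spike (ι 2ℚ) i) (i ∷ is)) * ∏L (List.map (spike (ι ℚ.½) j) (i ∷ is))
          ≈⟨ *-cong (*-cong (spike-diag (ι 2ℚ) i) (proj₂ (proj₂ (∏-spike-2 i is)))) (∏-spike-∉ (ι ℚ.½) j∉) ⟩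
        ι 2ℚ * ι q′ * 1#
          ≈⟨ *-identityʳ _ ⟩
        ι 2ℚ * ι q′
          ≈⟨ ι-* 2ℚ q′ ⟨
        ι (2ℚ ℚ.* q′) ∎
        where open ≈-Reasoning

    Unique⇒∏-allFin : ∀ {n} (s : Fin n → K) {is} → length is ≡ n → Unique is →
      ∏L (List.map s is) ≈ ∏ (Vec.map s (Vec.allFin n))
    Unique⇒∏-allFin {n} s len u = ≈-trans (≈-sym (go (↭.map⁺ s (Unique⇒allFin-↭ len u))))
      (≈-sym (≡⇒≈ (≡.trans (∏-map-toList s (Vec.allFin n)) (≡.cong (∏L ∘ List.map s) (toList-allFin n)))))
      where
      go : ∀ {xs ys} → xs ↭ ys → ∏L xs ≈ ∏L ys
      go refl         = ≈-refl
      go (prep x p)   = *-congˡ (go p)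
      go (swap x y p) = ≈-trans (*-congˡ (*-congˡ (go p)))
        (solve 3 (λ a b c → a :* (b :* c) := b :* (a :* c)) ≈-refl x y _)
        where open R-Solver
      go (trans p q)  = ≈-trans (go p) (go q)

    -- Induction on the list of unbalanced monomials. Removing one of them multiplies each other
    -- coefficient by `(χ y - χ x) / (1 - χ x)` but leaves the words alone; so the coefficients are
    -- a separate argument, free to change, and the hypothesis concerns the words only.
    balanced-part : ∀ {m n d} {X : Set} (f G : (Vec (Fin n) m → K) → K) →
      (∀ s → ∏ (Vec.map s (Vec.allFin n)) ≈ 1# → ∀ w → f (act (diagonal s) w) ≈ f w) →
      (∀ s → ∏ (Vec.map s (Vec.allFin n)) ≈ 1# → ∀ w → G (act (diagonal s) w) ≈ G w) →
      (xs : List X) (c : X → K) (Is : X → Vec (Vec (Fin n) m) d) →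
      (∀ {x} → x ∈ xs → Unbalanced (toList (concat (Is x)))) →
      (∀ w → f w ≈ G w + ∑ xs (λ x → c x * ∏ (Vec.map w (Is x)))) →
      ∀ w → f w ≈ G w
    balanced-part f G f-inv G-inv []       c Is unb f≈ w = ≈-trans (f≈ w) (+-identityʳ _)
    balanced-part {n = n} f G f-inv G-inv (x ∷ xs) c Is unb f≈ =
      balanced-part f G f-inv G-inv xs (λ y → r * (c y * (χ y + - χ x))) Is (unb ∘ there) f≈′
      where
      s = proj₁ (unb (here ≡.refl))
      ∏s≈1 = proj₁ (proj₂ (unb (here ≡.refl)))
      r = proj₁ (proj₂ (proj₂ (unb (here ≡.refl))))
      r-inverse = proj₂ (proj₂ (proj₂ (unb (here ≡.refl))))
      χ : _ → K
      χ y = ∏L (List.map s (toList (concat (Is y))))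
      M = λ w y → ∏ (Vec.map w (Is y))
      -- Applying (T - χ x) / (1 - χ x), T being the action of the torus element, fixes
      -- f and G and kills the first monomial.
      f≈′ : ∀ w → f w ≈ G w + ∑ xs (λ y → r * (c y * (χ y + - χ x)) * M w y)
      f≈′ w = begin
        f w
          ≈⟨ rescale (f w) ⟨
        r * (f w + - χ x * f w)
          ≈⟨ *-congˡ (+-cong twisted (*-congˡ (f≈ w))) ⟩
        r * ((G w + (c x * (χ x * M w x) + ∑ xs (λ y → c y * (χ y * M w y))))
          + - χ x * (G w + (c x * M w x + ∑ xs (λ y → c y * M w y))))
          -- The solver has no negation: `- χ x` enters as an independent variable `k`, and
          -- `χ x + - χ x` is cancelled in the following step.
          ≈⟨ *-congˡ (solve 7 (λ g a b m s t k → (g :+ (a :* (b :* m) :+ s)) :+ k :* (g :+ (a :* m :+ t))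
               := (g :+ k :* g) :+ ((b :+ k) :* (a :* m) :+ (s :+ k :* t))) ≈-refl
               (G w) (c x) (χ x) (M w x) (∑ xs (λ y → c y * (χ y * M w y))) (∑ xs (λ y → c y * M w y)) (- χ x)) ⟩
        r * ((G w + - χ x * G w) + ((χ x + - χ x) * (c x * M w x)
          + (∑ xs (λ y → c y * (χ y * M w y)) + - χ x * ∑ xs (λ y → c y * M w y))))
          ≈⟨ *-congˡ (+-congˡ (+-cong (≈-trans (*-congʳ (-‿inverseʳ (χ x))) (zeroˡ _)) rest)) ⟩
        r * ((G w + - χ x * G w) + (0# + ∑ xs (λ y → c y * (χ y + - χ x) * M w y)))
          ≈⟨ distribˡ r _ _ ⟩
        r * (G w + - χ x * G w) + r * (0# + ∑ xs (λ y → c y * (χ y + - χ x) * M w y))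
          ≈⟨ +-cong (rescale (G w)) (≈-trans (*-congˡ (+-identityˡ _)) (≈-trans (∑-*ˡ r xs _)
               (∑-cong xs (λ y → ≈-sym (*-assoc r _ (M w y)))))) ⟩
        G w + ∑ xs (λ y → r * (c y * (χ y + - χ x)) * M w y) ∎
        where
        open ≈-Reasoning
        open R-Solver
        rescale : ∀ a → r * (a + - χ x * a) ≈ a
        rescale a = ≈-trans (solve 3 (λ r a k → r :* (a :+ k :* a) := r :* (con 1 :+ k) :* a) ≈-refl r a (- χ x))
          (≈-trans (*-congʳ r-inverse) (*-identityˡ a))
        scaled : ∀ y → M (act (diagonal s) w) y ≈ χ y * M w y
        scaled y = ≈-trans (monomial-diagonal s w (Is y)) (*-congʳ (≡⇒≈ (∏-map-toList s (concat (Is y)))))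
        twisted : f w ≈ G w + (c x * (χ x * M w x) + ∑ xs (λ y → c y * (χ y * M w y)))
        twisted = ≈-trans (≈-sym (f-inv s ∏s≈1 w)) (≈-trans (f≈ (act (diagonal s) w))
          (+-cong (G-inv s ∏s≈1 w) (+-cong (*-congˡ (scaled x)) (∑-cong xs (λ y → *-congˡ (scaled y))))))
        rest : ∑ xs (λ y → c y * (χ y * M w y)) + - χ x * ∑ xs (λ y → c y * M w y) ≈
               ∑ xs (λ y → c y * (χ y + - χ x) * M w y)
        rest = ≈-trans (+-congˡ (∑-*ˡ (- χ x) xs _)) (≈-trans (≈-sym (∑-+ xs _ _))
          (∑-cong xs (λ y → solve 4 (λ a b k m → a :* (b :* m) :+ k :* (a :* m) := a :* (b :+ k) :* m)
            ≈-refl (c y) (χ y) (- χ x) (M w y))))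

    -- Reindexing along a permutation

    Vec-ext : ∀ {n} {xs ys : Vec A n} → (∀ i → lookup xs i ≡ lookup ys i) → xs ≡ ys
    Vec-ext {xs = xs} {ys} eq = ≡.trans (≡.sym (Vec.tabulate∘lookup xs))
      (≡.trans (Vec.tabulate-cong eq) (Vec.tabulate∘lookup ys))

    toList-Unique⁻ : ∀ {n} (xs : Vec A n) → Unique (toList xs) → VecUnique xs
    toList-Unique⁻ []       []       = VecAllPairs.[]
    toList-Unique⁻ (x ∷ xs) (x# ∷ u) = go xs x# VecAllPairs.∷ toList-Unique⁻ xs u
      where
      go : ∀ {k} (ys : Vec _ k) → All (x ≢_) (toList ys) → VecAll.All (x ≢_) ys
      go []       []       = VecAll.[]
      go (y ∷ ys) (p ∷ ps) = p VecAll.∷ go ys ps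

    toList-Unique-injective : ∀ {n} (xs : Vec A n) → Unique (toList xs) → ∀ {i j} → lookup xs i ≡ lookup xs j → i ≡ j
    toList-Unique-injective xs u {i} {j} = VecUnique.lookup-injective (toList-Unique⁻ xs u) i j

    infixr 9 _⊚_
    -- Composition of words, read as functions of the position.
    _⊚_ : ∀ {n m} → Vec A n → Vec (Fin n) m → Vec A m
    xs ⊚ J = Vec.map (lookup xs) J

    lookup-⊚ : ∀ {n m} (xs : Vec A n) (J : Vec (Fin n) m) i → lookup (xs ⊚ J) i ≡ lookup xs (lookup J i)
    lookup-⊚ xs J i = Vec.lookup-map i (lookup xs) J

    module Inverse {n} (J : Vec (Fin n) n) (u : Unique (toList J)) where
      J∋ : ∀ i → i ∈ toList J
      J∋ i = ↭.∈-resp-↭ (Unique⇒allFin-↭ (Vec.length-toList J) u) (∈-allFin i)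

      J⁻¹ : Vec (Fin n) n
      J⁻¹ = Vec.tabulate (λ i → VecAny.index (VecMembership.∈-toList⁻ (J∋ i)))

      lookup-inverseʳ : ∀ i → lookup J (lookup J⁻¹ i) ≡ i
      lookup-inverseʳ i = ≡.trans (≡.cong (lookup J) (Vec.lookup∘tabulate _ i))
        (≡.sym (VecAny.lookup-index (VecMembership.∈-toList⁻ (J∋ i))))

      lookup-inverseˡ : ∀ i → lookup J⁻¹ (lookup J i) ≡ i
      lookup-inverseˡ i = toList-Unique-injective J u (lookup-inverseʳ (lookup J i))

      ⊚-inverseˡ : ∀ (xs : Vec A n) → (xs ⊚ J⁻¹) ⊚ J ≡ xs
      ⊚-inverseˡ xs = Vec-ext (λ i → ≡.trans (lookup-⊚ (xs ⊚ J⁻¹) J i)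
        (≡.trans (lookup-⊚ xs J⁻¹ (lookup J i)) (≡.cong (lookup xs) (lookup-inverseˡ i))))

      ⊚-inverseʳ : ∀ (xs : Vec A n) → (xs ⊚ J) ⊚ J⁻¹ ≡ xs
      ⊚-inverseʳ xs = Vec-ext (λ i → ≡.trans (lookup-⊚ (xs ⊚ J) J⁻¹ i)
        (≡.trans (lookup-⊚ xs J (lookup J⁻¹ i)) (≡.cong (lookup xs) (lookup-inverseʳ i))))

      J⊚J⁻¹ : J ⊚ J⁻¹ ≡ Vec.allFin n
      J⊚J⁻¹ = Vec-ext (λ i → ≡.trans (lookup-⊚ J J⁻¹ i)
        (≡.trans (lookup-inverseʳ i) (≡.sym (Vec.lookup-allFin i))))

    -- Multiplicativity of the sign, valid for all words: as a function of `J`, the left side is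
    -- alternating with value `ε (toList I)` at the identity.
    ε-⊚ : ∀ {n} (I J : Vec (Fin n) n) → ε (toList (I ⊚ J)) ≈ ε (toList J) * ε (toList I)
    ε-⊚ {n} I J = begin
      ε (toList (I ⊚ J))
        ≈⟨ ≡⇒≈ (≡.cong ε (Vec.toList-map (lookup I) J)) ⟩
      ε (List.map (lookup I) (toList J))
        ≈⟨ alternating-determined (alternating-map {α = ε} (lookup I) ε-alternating) (toList J) (Vec.length-toList J) ⟩
      ε (toList J) * ε (List.map (lookup I) (List.allFin n))
        ≈⟨ *-congˡ (≡⇒≈ (≡.cong ε (map-lookup-allFin I))) ⟩
      ε (toList J) * ε (toList I) ∎
      where open ≈-Reasoning

    ∏-e-≡ : ∀ {m n} {I J : Vec (Fin n) m} → I ≡ J → ∏ (Vec.zipWith e I J) ≈ 1#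
    ∏-e-≡ {I = []}    ≡.refl = ≈-refl
    ∏-e-≡ {I = i ∷ I} ≡.refl = ≈-trans (*-cong (e-diag i) (∏-e-≡ {I = I} ≡.refl)) (*-identityˡ 1#)

    ∏-e-≢ : ∀ {m n} (I J : Vec (Fin n) m) → I ≢ J → ∏ (Vec.zipWith e I J) ≈ 0#
    ∏-e-≢ []      []      I≢J = ⊥-elim (I≢J ≡.refl)
    ∏-e-≢ (i ∷ I) (j ∷ J) I≢J with i Fin.≟ j
    ... | yes ≡.refl = ≈-trans (*-congˡ (∏-e-≢ I J (I≢J ∘ ≡.cong (i ∷_)))) (zeroʳ _)
    ... | no _       = zeroˡ _

    ∏-e-⇔ : ∀ {m n k l} (I J : Vec (Fin n) m) (I′ J′ : Vec (Fin l) k) →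
      (I ≡ J → I′ ≡ J′) → (I′ ≡ J′ → I ≡ J) → ∏ (Vec.zipWith e I J) ≈ ∏ (Vec.zipWith e I′ J′)
    ∏-e-⇔ I J I′ J′ to from with Vec.≡-dec Fin._≟_ I J
    ... | yes p = ≈-trans (∏-e-≡ p) (≈-sym (∏-e-≡ (to p)))
    ... | no ¬p = ≈-trans (∏-e-≢ I J ¬p) (≈-sym (∏-e-≢ I′ J′ (¬p ∘ from)))

    -- Composition with `J` on the right is a bijection on all words. The delta of `I` and `π ⊚ J`
    -- is that of `π` and `I ⊚ J⁻¹`, so the inner sum evaluates `ε` at `I ⊚ J⁻¹`.
    antisymmetrize-⊚ : ∀ {n} (J : Vec (Fin n) n) → Unique (toList J) → (f : Vec (Fin n) n → K) →
      ∑ (indices n n) (λ π → ε (toList π) * f (π ⊚ J)) ≈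
      ε (toList J) * ∑ (indices n n) (λ π → ε (toList π) * f π)
    antisymmetrize-⊚ {n} J u f = begin
      ∑ N (λ π → ε (toList π) * f (π ⊚ J))
        ≈⟨ ∑-cong N (λ π → ≈-trans (*-congˡ (≈-sym (∑-δ f (π ⊚ J)))) (∑-*ˡ _ N _)) ⟩
      ∑ N (λ π → ∑ N (λ I → ε (toList π) * (f I * ∏ (Vec.zipWith e I (π ⊚ J)))))
        ≈⟨ ∑-swap N N _ ⟩
      ∑ N (λ I → ∑ N (λ π → ε (toList π) * (f I * ∏ (Vec.zipWith e I (π ⊚ J)))))
        ≈⟨ ∑-cong N (λ I → ≈-trans (∑-cong N (λ π → term π I)) (≈-sym (∑-*ˡ (f I) N _))) ⟩
      ∑ N (λ I → f I * ∑ N (λ π → ε (toList π) * ∏ (Vec.zipWith e π (I ⊚ J⁻¹))))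
        ≈⟨ ∑-cong N (λ I → *-congˡ (≈-trans (∑-δ (ε ∘ toList) (I ⊚ J⁻¹)) (≈-trans (ε-⊚ I J⁻¹) (*-congʳ ε-inverse)))) ⟩
      ∑ N (λ I → f I * (ε (toList J) * ε (toList I)))
        ≈⟨ ∑-cong N (λ I →
             solve 3 (λ a b c → a :* (b :* c) := b :* (c :* a)) ≈-refl (f I) (ε (toList J)) (ε (toList I))) ⟩
      ∑ N (λ I → ε (toList J) * (ε (toList I) * f I))
        ≈⟨ ∑-*ˡ (ε (toList J)) N _ ⟨
      ε (toList J) * ∑ N (λ π → ε (toList π) * f π) ∎
      where
      open Inverse J u
      open ≈-Reasoning
      open R-Solver
      N = indices n n
      term : ∀ π I → ε (toList π) * (f I * ∏ (Vec.zipWith e I (π ⊚ J))) ≈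
                     f I * (ε (toList π) * ∏ (Vec.zipWith e π (I ⊚ J⁻¹)))
      term π I = ≈-trans
        (*-congˡ (*-congˡ (∏-e-⇔ I (π ⊚ J) π (I ⊚ J⁻¹)
          (λ { ≡.refl → ≡.sym (⊚-inverseʳ π) }) (λ { ≡.refl → ≡.sym (⊚-inverseˡ I) }))))
        (solve 3 (λ a b c → a :* (b :* c) := b :* (a :* c)) ≈-refl (ε (toList π)) (f I) _)
      id-n = Vec.allFin n
      ε-inverse : ε (toList J⁻¹) ≈ ε (toList J)
      ε-inverse = begin
        ε (toList J⁻¹)
          ≈⟨ *-identityʳ _ ⟨
        ε (toList J⁻¹) * 1#
          ≈⟨ *-congˡ (ε²≈1 (Vec.length-toList J) u) ⟨
        ε (toList J⁻¹) * (ε (toList J) * ε (toList J))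
          ≈⟨ *-assoc _ _ _ ⟨
        ε (toList J⁻¹) * ε (toList J) * ε (toList J)
          ≈⟨ *-congʳ (ε-⊚ J J⁻¹) ⟨
        ε (toList (J ⊚ J⁻¹)) * ε (toList J)
          ≈⟨ *-congʳ (≡⇒≈ (≡.cong (ε ∘ toList) J⊚J⁻¹)) ⟩
        ε (toList id-n) * ε (toList J)
          ≈⟨ *-congʳ (≈-trans (≡⇒≈ (≡.cong ε (toList-allFin n))) (ε-allFin n)) ⟩
        1# * ε (toList J)
          ≈⟨ *-identityˡ _ ⟩
        ε (toList J) ∎

    -- Averaging over signed permutation matrices

    module _ {n} (i₀ : Fin n) (π : Vec (Fin n) n) where
      private
        s : Fin n → K
        s = spike (ε (toList π)) i₀

      -- For a permutation `π`, scaling the column `i₀` by `ε π` corrects the determinant to 1. A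
      -- word that uses every letter exactly once meets this column once and picks up exactly one
      -- sign.
      signedPermutation : Fin n → Fin n → K
      signedPermutation = monomialMatrix (lookup π) s

      ∏-signs : ∀ {is} → length is ≡ n → Unique is → ∏L (List.map s is) ≈ ε (toList π)
      ∏-signs len u = ∏-spike-∈ (ε (toList π)) u (↭.∈-resp-↭ (Unique⇒allFin-↭ len u) (∈-allFin i₀))

      det-signedPermutation : Unique (toList π) → det signedPermutation ≈ 1#
      det-signedPermutation u = begin
        det signedPermutation
          ≈⟨ *-identityˡ _ ⟨
        1# * det signedPermutation
          ≈⟨ *-congʳ (ε²≈1 (Vec.length-toList π) u) ⟨
        ε (toList π) * ε (toList π) * det signedPermutation
          ≈⟨ *-assoc _ _ _ ⟩
        ε (toList π) * (ε (toList π) * det signedPermutation)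
          ≈⟨ *-congˡ (*-congʳ (≡⇒≈ (≡.cong (ε ∘ toList) (≡.sym (Vec.map-lookup-allFin π))))) ⟩
        ε (toList π) * (ε (toList (Vec.map (lookup π) (Vec.allFin n))) * det signedPermutation)
          ≈⟨ *-congˡ (det-monomialMatrix (lookup π) s (toList-Unique-injective π u)) ⟩
        ε (toList π) * ∏ (Vec.map s (Vec.allFin n))
          ≈⟨ *-congˡ (≡⇒≈ (≡.trans (∏-map-toList s (Vec.allFin n)) (≡.cong (∏L ∘ List.map s) (toList-allFin n)))) ⟩
        ε (toList π) * ∏L (List.map s (List.allFin n))
          ≈⟨ *-congˡ (∏-signs length-allFin (Unique.allFin⁺ n)) ⟩
        ε (toList π) * ε (toList π)
          ≈⟨ ε²≈1 (Vec.length-toList π) u ⟩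
        1# ∎
        where open ≈-Reasoning

      monomial-signedPermutation : ∀ {m d} (w : Vec (Fin n) m → K) (Is : Vec (Vec (Fin n) m) d) →
        d ℕ.* m ≡ n → Unique (toList (concat Is)) →
        ∏ (Vec.map (act signedPermutation w) Is) ≈ ∏ (Vec.map w (Vec.map (π ⊚_) Is)) * ε (toList π)
      monomial-signedPermutation w Is eq u = ≈-trans (monomial-monomialMatrix (lookup π) s w Is)
        (*-congˡ (≈-trans (≡⇒≈ (∏-map-toList s (concat Is)))
          (∏-signs (≡.trans (Vec.length-toList (concat Is)) eq) u)))

    -- Invariants of low and of top degree

    Polynomial : ℕ → ℕ → ℕ → Set
    Polynomial m n d = List (K × Vec (Vec (Fin n) m) d)

    evaluate : ∀ {m n d} → Polynomial m n d → (Vec (Fin n) m → K) → K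
    evaluate ts w = ∑ ts (λ t → proj₁ t * ∏ (Vec.map w (proj₂ t)))

    word : ∀ {m n d} → K × Vec (Vec (Fin n) m) d → List (Fin n)
    word t = toList (concat (proj₂ t))

    -- The head serves as the letter to which the torus element gives the entry 2. The empty word
    -- has to be excluded: every torus element fixes the constants.
    unbalanced-or-⊇ : ∀ {n} {is : List (Fin n)} → 0 ℕ.< length is → Unbalanced is ⊎ (∀ i → i ∈ is)
    unbalanced-or-⊇ {is = i ∷ is} _ with missing-or-⊇ (i ∷ is)
    ... | inj₁ (j , j∉) = inj₁ (missing⇒unbalanced {i = i} {j} {is} j∉)
    ... | inj₂ all∈     = inj₂ all∈

    partition : ∀ {A : Set} {P Q : A → Set} → (∀ x → P x ⊎ Q x) → (xs : List A) →
      ∃₂ λ ys zs → (∀ {y} → y ∈ ys → P y) × (∀ {z} → z ∈ zs → Q z) × (∀ f → ∑ xs f ≈ ∑ zs f + ∑ ys f)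
    partition P⊎Q [] = [] , [] , (λ ()) , (λ ()) , λ f → ≈-sym (+-identityˡ 0#)
    partition P⊎Q (x ∷ xs) with P⊎Q x | partition P⊎Q xs
    ... | inj₁ p | ys , zs , Pys , Qzs , ∑≈ = x ∷ ys , zs , (λ { (here ≡.refl) → p ; (there y∈) → Pys y∈ }) , Qzs ,
      λ f → ≈-trans (+-congˡ (∑≈ f)) (solve 3 (λ a b c → a :+ (b :+ c) := b :+ (a :+ c)) ≈-refl (f x) (∑ zs f) (∑ ys f))
      where open R-Solver
    ... | inj₂ q | ys , zs , Pys , Qzs , ∑≈ = ys , x ∷ zs , Pys , (λ { (here ≡.refl) → q ; (there z∈) → Qzs z∈ }) ,
      λ f → ≈-trans (+-congˡ (∑≈ f)) (≈-sym (+-assoc _ _ _))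

    module _ {m n d} (ts : Polynomial m n d) (dm>0 : 0 ℕ.< d ℕ.* m)
      (invariant : ∀ g → det g ≈ 1# → ∀ w → evaluate ts (act g w) ≈ evaluate ts w) where

      private
        length-word : ∀ (t : K × Vec (Vec (Fin n) m) d) → length (word t) ≡ d ℕ.* m
        length-word t = Vec.length-toList (concat (proj₂ t))

        torus-invariant : ∀ s → ∏ (Vec.map s (Vec.allFin n)) ≈ 1# →
          ∀ w → evaluate ts (act (diagonal s) w) ≈ evaluate ts w
        torus-invariant s ∏s≈1 = invariant (diagonal s) (≈-trans (det-diagonal s) ∏s≈1)

        word>0 : ∀ (t : K × Vec (Vec (Fin n) m) d) → 0 ℕ.< length (word t)
        word>0 t = ≡.subst (0 ℕ.<_) (≡.sym (length-word t)) dm>0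

      low-degree : d ℕ.* m ℕ.< n → ∀ w → evaluate ts w ≈ 0#
      low-degree dm<n = balanced-part (evaluate ts) (λ _ → 0#) torus-invariant (λ _ _ _ → ≈-refl)
        ts proj₁ proj₂ (λ {t} _ → unbalanced t) (λ w → ≈-sym (+-identityˡ _))
        where
        unbalanced : ∀ (t : K × Vec (Vec (Fin n) m) d) → Unbalanced (word t)
        unbalanced t with unbalanced-or-⊇ {is = word t} (word>0 t)
        ... | inj₁ unb  = unb
        ... | inj₂ all∈ = ⊥-elim (ℕ.<⇒≱ dm<n (ℕ.≤-reflexive (≡.trans (≡.sym length-allFin)
          (≡.trans (↭.↭-length (⊇⇒allFin-↭ (ℕ.≤-trans (ℕ.≤-reflexive (length-word t)) (ℕ.<⇒≤ dm<n)) all∈))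
            (length-word t)))))

      module _ (dm≡n : d ℕ.* m ≡ n) where
        private
          unbalanced-or-unique : ∀ (t : K × Vec (Vec (Fin n) m) d) → Unbalanced (word t) ⊎ Unique (word t)
          unbalanced-or-unique t with unbalanced-or-⊇ {is = word t} (word>0 t)
          ... | inj₁ unb  = inj₁ unb
          ... | inj₂ all∈ = inj₂ (Unique-resp-↭
            (⊇⇒allFin-↭ (ℕ.≤-reflexive (≡.trans (length-word t) dm≡n)) all∈) (Unique.allFin⁺ n))

        -- A word that is a permutation has eigenvalue `∏ s = 1` for every torus element in
        -- question, so the monomials of such words form the fixed part `G` of `balanced-part`.
        multilinear : ∃ λ (us : Polynomial m n d) → (∀ {u} → u ∈ us → Unique (word u)) ×
          (∀ w → evaluate ts w ≈ evaluate us w)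
        multilinear with partition unbalanced-or-unique ts
        ... | bs , us , unb , uniq , ∑≈ = us , uniq ,
          balanced-part (evaluate ts) (evaluate us) torus-invariant us-invariant bs proj₁ proj₂ unb
            (λ w → ∑≈ (λ t → proj₁ t * ∏ (Vec.map w (proj₂ t))))
          where
          us-invariant : ∀ s → ∏ (Vec.map s (Vec.allFin n)) ≈ 1# →
            ∀ w → evaluate us (act (diagonal s) w) ≈ evaluate us w
          us-invariant s ∏s≈1 w = ∑-cong∈ us (λ {u} u∈ → *-congˡ (≈-trans (monomial-diagonal s w (proj₂ u))
            (≈-trans (*-congʳ (≈-trans (≡⇒≈ (∏-map-toList s (concat (proj₂ u))))
              (≈-trans (Unique⇒∏-allFin s {word u} (≡.trans (length-word u) dm≡n) (uniq u∈)) ∏s≈1))) (*-identityˡ _))))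

    -- From tuples of blocks to single words

    concat-injective : ∀ {m d} (Is Js : Vec (Vec A m) d) → concat Is ≡ concat Js → Is ≡ Js
    concat-injective []       []       _  = ≡.refl
    concat-injective (I ∷ Is) (J ∷ Js) eq =
      ≡.cong₂ _∷_ (Vec.++-injectiveˡ I J eq) (concat-injective Is Js (Vec.++-injectiveʳ I J eq))

    module _ m d (w : Vec (Fin (d ℕ.* m)) m → K) where
      private
        n = d ℕ.* m

      -- A monomial as a function of one word of length `n`, the form to which `antisymmetrize-⊚`
      -- applies.
      flatMonomial : Vec (Fin n) n → K
      flatMonomial I = ∏ (Vec.map w (proj₁ (Vec.group d m I)))

      flatMonomial-concat : ∀ Is → flatMonomial (concat Is) ≡ ∏ (Vec.map w Is)
      flatMonomial-concat Is = ≡.cong (∏ ∘ Vec.map w)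
        (concat-injective (proj₁ (Vec.group d m (concat Is))) Is (≡.sym (proj₂ (Vec.group d m (concat Is)))))

      ∑-flatMonomial : ∑ (indices n n) (λ π → ε (toList π) * flatMonomial π) ≈ Pf m d w
      ∑-flatMonomial = ≈-trans (≈-sym (∑-concat (List.allFin n) m d (λ π → ε (toList π) * flatMonomial π)))
        (∑-cong (tuples (indices m n) d) (λ Is → *-congˡ (≡⇒≈ (flatMonomial-concat Is))))

      antisymmetrize-monomial : ∀ Is → Unique (toList (concat Is)) →
        ∑ (indices n n) (λ π → ε (toList π) * ∏ (Vec.map w (Vec.map (π ⊚_) Is))) ≈
        ε (toList (concat Is)) * Pf m d w
      antisymmetrize-monomial Is u = ≈-trans
        (∑-cong (indices n n) (λ π → *-congˡ (≡⇒≈ (≡.trans (≡.sym (flatMonomial-concat (Vec.map (π ⊚_) Is)))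
          (≡.cong flatMonomial (≡.sym (Vec.map-concat (lookup π) Is)))))))
        (≈-trans (antisymmetrize-⊚ (concat Is) u flatMonomial) (*-congˡ ∑-flatMonomial))

    top-degree : ∀ {m d} (ts : Polynomial m (d ℕ.* m) d) → Fin (d ℕ.* m) →
      (∀ g → det g ≈ 1# → ∀ w → evaluate ts (act g w) ≈ evaluate ts w) →
      ∃ λ c → ∀ w → evaluate ts w ≈ c * Pf m d w
    top-degree {m} {d} ts i₀ invariant = ι (ℚ.1/ q) * c , λ w → begin
      f w
        ≈⟨ *-identityˡ _ ⟨
      1# * f w
        ≈⟨ *-congʳ (≈-trans (≈-sym ι-1) (≈-trans (≡⇒≈ (≡.cong ι (≡.sym (ℚ.*-inverseˡ q)))) (ι-* (ℚ.1/ q) q))) ⟩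
      ι (ℚ.1/ q) * ι q * f w
        ≈⟨ *-assoc _ _ _ ⟩
      ι (ℚ.1/ q) * (ι q * f w)
        ≈⟨ *-congˡ (≈-trans (*-congʳ (≈-sym (proj₂ (proj₂ order)))) (average w)) ⟩
      ι (ℚ.1/ q) * (c * Pf m d w)
        ≈⟨ *-assoc _ _ _ ⟨
      ι (ℚ.1/ q) * c * Pf m d w ∎
      where
      open ≈-Reasoning
      n = d ℕ.* m
      f = evaluate ts
      N = indices n n
      reduced = multilinear ts (ℕ.>-nonZero⁻¹ n {{Fin.nonZeroIndex i₀}}) invariant ≡.refl
      us = proj₁ reduced
      uniq = proj₁ (proj₂ reduced)
      f≈us = proj₂ (proj₂ reduced)
      c = ∑ us (λ u → proj₁ u * ε (word u))

      -- The indicator function of permutations. Its sum `q` is the order of the symmetric group, of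
      -- which only `q ≥ 1` is needed for the division.
      ε² : Vec (Fin n) n → K
      ε² π = ε (toList π) * ε (toList π)
      ε²-ZeroOne : ∀ π → ZeroOne (ε² π)
      ε²-ZeroOne π with unique-or-repetition Fin._≟_ (toList π)
      ... | inj₁ u           = inj₂ (ε²≈1 (Vec.length-toList π) u)
      ... | inj₂ (_ , _ , p) = inj₁ (≈-trans (*-congʳ (alternating-vanish ε-alternating p)) (zeroˡ _))
      order = ∑-ZeroOne≥1 ε²-ZeroOne (∈-tuples (Vec.allFin n) ∈-allFin)
        (ε²≈1 (Vec.length-toList (Vec.allFin n)) (≡.subst Unique (≡.sym (toList-allFin n)) (Unique.allFin⁺ n)))
      q = proj₁ order
      instance
        q≢0 : ℚ.NonZero q
        q≢0 = ℚ.pos⇒nonZero q {{ℚ.positive (ℚ.<-≤-trans (ℚ.positive⁻¹ 1ℚ) (proj₁ (proj₂ order)))}}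

      -- The factor `ε² π` extends the identity from permutations, where it expresses invariance
      -- under `signedPermutation i₀ π`, to all words.
      translate : ∀ w π → ε² π * f w ≈
        ∑ us (λ u → proj₁ u * (ε (toList π) * ∏ (Vec.map w (Vec.map (π ⊚_) (proj₂ u)))))
      translate w π with unique-or-repetition Fin._≟_ (toList π)
      ... | inj₂ (_ , _ , p) = ≈-trans (*-congʳ (≈-trans (*-congʳ ε≈0) (zeroˡ _))) (≈-trans (zeroˡ _)
        (≈-sym (≈-trans (∑-cong us (λ u → ≈-trans (*-congˡ (≈-trans (*-congʳ ε≈0) (zeroˡ _))) (zeroʳ _))) (∑-zero us))))
        where ε≈0 = alternating-vanish ε-alternating p
      ... | inj₁ u = begin
        ε² π * f w
          ≈⟨ *-congʳ (ε²≈1 (Vec.length-toList π) u) ⟩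
        1# * f w
          ≈⟨ *-identityˡ _ ⟩
        f w
          ≈⟨ invariant (signedPermutation i₀ π) (det-signedPermutation i₀ π u) w ⟨
        f (act (signedPermutation i₀ π) w)
          ≈⟨ f≈us _ ⟩
        evaluate us (act (signedPermutation i₀ π) w)
          ≈⟨ ∑-cong∈ us (λ {u} u∈ → *-congˡ (≈-trans
               (monomial-signedPermutation i₀ π w (proj₂ u) ≡.refl (uniq u∈)) (*-comm _ _))) ⟩
        ∑ us (λ u → proj₁ u * (ε (toList π) * ∏ (Vec.map w (Vec.map (π ⊚_) (proj₂ u))))) ∎

      average : ∀ w → ∑ N ε² * f w ≈ c * Pf m d w
      average w = begin
        ∑ N ε² * f w
          ≈⟨ ∑-*ʳ (f w) N ε² ⟩
        ∑ N (λ π → ε² π * f w)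
          ≈⟨ ∑-cong N (translate w) ⟩
        ∑ N (λ π → ∑ us (λ u → proj₁ u * (ε (toList π) * ∏ (Vec.map w (Vec.map (π ⊚_) (proj₂ u))))))
          ≈⟨ ∑-swap N us _ ⟩
        ∑ us (λ u → ∑ N (λ π → proj₁ u * (ε (toList π) * ∏ (Vec.map w (Vec.map (π ⊚_) (proj₂ u))))))
          ≈⟨ ∑-cong∈ us (λ {u} u∈ → ≈-trans (≈-sym (∑-*ˡ (proj₁ u) N _))
               (≈-trans (*-congˡ (antisymmetrize-monomial m d w (proj₂ u) (uniq u∈))) (≈-sym (*-assoc _ _ _)))) ⟩
        ∑ us (λ u → proj₁ u * ε (word u) * Pf m d w)
          ≈⟨ ∑-*ʳ (Pf m d w) us _ ⟨
        c * Pf m d w ∎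

open import Defs

-- Real and complex numbers

≡⇒≈ℝ : ∀ x y → (∀ n → seq x n ≡ seq y n) → x ≈ℝ y
≡⇒≈ℝ x y x≡y ε = 0 , λ n _ →
  subst (ℚ._< ε) (≡.sym (cong ℚ.∣_∣ (≡.trans (cong (ℚ._- seq y n) (x≡y n)) (ℚ.+-inverseʳ (seq y n)))))
    (ℚ.positive⁻¹ ε)

≈ℝ-refl : ∀ x → x ≈ℝ x
≈ℝ-refl x = ≡⇒≈ℝ x x (λ _ → refl)

≈ℝ-sym : ∀ {x y} → x ≈ℝ y → y ≈ℝ x
≈ℝ-sym {x} {y} x≈y ε with x≈y ε
... | N , close = N , λ n n≥ →
  subst (ℚ._< ε)
    (≡.trans (≡.sym (ℚ.∣-p∣≡∣p∣ (seq x n ℚ.- seq y n))) (cong ℚ.∣_∣ (flip (seq x n) (seq y n))))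
    (close n n≥)
  where
  open ℚ-Solver.+-*-Solver
  flip : ∀ p q → ℚ.- (p ℚ.- q) ≡ q ℚ.- p
  flip = solve 2 (λ p q → :- (p :- q) := q :- p) refl

≈ℝ-trans : ∀ {x y z} → x ≈ℝ y → y ≈ℝ z → x ≈ℝ z
≈ℝ-trans {x} {y} {z} x≈y y≈z ε
  with x≈y (½ ℚ.* ε) {{½ε ε}} | y≈z (½ ℚ.* ε) {{½ε ε}}
... | M , p | N , q = M ⊔ N , λ n n≥ →
  subst (λ r → ℚ.∣ r ∣ ℚ.< ε) (telescope (seq x n) (seq y n) (seq z n))
    (+-small {ε} (seq x n ℚ.- seq y n) (seq y n ℚ.- seq z n)
      (p n (ℕ.m⊔n≤o⇒m≤o M N n≥)) (q n (ℕ.m⊔n≤o⇒n≤o M N n≥)))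
  where
  open ℚ-Solver.+-*-Solver
  telescope : ∀ a b c → (a ℚ.- b) ℚ.+ (b ℚ.- c) ≡ a ℚ.- c
  telescope = solve 3 (λ a b c → (a :- b) :+ (b :- c) := a :- c) refl

+ℝ-cong : ∀ {x y u v} → x ≈ℝ y → u ≈ℝ v → x +ℝ u ≈ℝ y +ℝ v
+ℝ-cong {x} {y} {u} {v} x≈y u≈v ε
  with x≈y (½ ℚ.* ε) {{½ε ε}} | u≈v (½ ℚ.* ε) {{½ε ε}}
... | M , p | N , q = M ⊔ N , λ n n≥ →
  subst (λ r → ℚ.∣ r ∣ ℚ.< ε) (regroup (seq x n) (seq y n) (seq u n) (seq v n))
    (+-small {ε} (seq x n ℚ.- seq y n) (seq u n ℚ.- seq v n)
      (p n (ℕ.m⊔n≤o⇒m≤o M N n≥)) (q n (ℕ.m⊔n≤o⇒n≤o M N n≥)))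
  where
  open ℚ-Solver.+-*-Solver
  regroup : ∀ a b c d → (a ℚ.- b) ℚ.+ (c ℚ.- d) ≡ (a ℚ.+ c) ℚ.- (b ℚ.+ d)
  regroup = solve 4 (λ a b c d → (a :- b) :+ (c :- d) := (a :+ c) :- (b :+ d)) refl

-ℝ-cong : ∀ {x y} → x ≈ℝ y → -ℝ x ≈ℝ -ℝ y
-ℝ-cong {x} {y} x≈y ε with x≈y ε
... | N , close = N , λ n n≥ →
  subst (ℚ._< ε)
    (≡.trans (≡.sym (ℚ.∣-p∣≡∣p∣ (seq x n ℚ.- seq y n)))
           (cong ℚ.∣_∣ (ℚ.neg-distrib-+ (seq x n) (ℚ.- seq y n))))
    (close n n≥)

Bounded : (ℕ → ℚ) → Set
Bounded x = ∃ λ (B : ℚ) → Positive B × ∃ λ N → ∀ n → N ℕ.≤ n → ℚ.∣ x n ∣ ℚ.≤ B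

*ℝ-cong : ∀ {x y u v} → x ≈ℝ y → u ≈ℝ v → x *ℝ u ≈ℝ y *ℝ v
*ℝ-cong {x} {y} {u} {v} x≈y u≈v ε =
  from-bounds (bounded {seq x} (cauchy x)) (bounded {seq v} (cauchy v))
  where
  from-bounds : Bounded (seq x) → Bounded (seq v) →
    ∃ λ N → ∀ n → N ℕ.≤ n → ℚ.∣ seq x n ℚ.* seq u n ℚ.- seq y n ℚ.* seq v n ∣ ℚ.< ε
  from-bounds (A , A>0 , K , x≤A) (B , B>0 , L , v≤B) =
    (K ⊔ L) ⊔ (M ⊔ N) , λ n n≥ →
      let n≥KL = ℕ.m⊔n≤o⇒m≤o (K ⊔ L) (M ⊔ N) n≥
          n≥MN = ℕ.m⊔n≤o⇒n≤o (K ⊔ L) (M ⊔ N) n≥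
      in *-close ε A B {{A>0}} {{B>0}} (seq x n) (seq y n) (seq u n) (seq v n)
           (x≤A n (ℕ.m⊔n≤o⇒m≤o K L n≥KL)) (proj₂ p n (ℕ.m⊔n≤o⇒m≤o M N n≥MN))
           (v≤B n (ℕ.m⊔n≤o⇒n≤o K L n≥KL)) (proj₂ q n (ℕ.m⊔n≤o⇒n≤o M N n≥MN))
    where
    p = u≈v (_÷₊_ (½ ℚ.* ε) A {{A>0}}) {{÷₊-pos (½ ℚ.* ε) A {{½ε ε}} {{A>0}}}}
    q = x≈y (_÷₊_ (½ ℚ.* ε) B {{B>0}}) {{÷₊-pos (½ ℚ.* ε) B {{½ε ε}} {{B>0}}}}
    M = proj₁ p
    N = proj₁ q

-- Unlike _≈_, this relation determines its two sides, so that they can be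
-- inferred.
infix 4 _≋_
record _≋_ (z w : ℂ) : Set where
  constructor wrap
  field unwrap : z ≈ w
open _≋_ public

pointwise⇒≋ : ∀ z w → (∀ n → seq (re z) n ≡ seq (re w) n) → (∀ n → seq (im z) n ≡ seq (im w) n) → z ≋ w
pointwise⇒≋ z w re≡ im≡ = wrap (≡⇒≈ℝ (re z) (re w) re≡ , ≡⇒≈ℝ (im z) (im w) im≡)

infixl 6 _⊕_
infixl 7 _⊛_
infix  8 ⊝_

-- Abstract copies of the operations, which do not unfold to Cauchy sequences.
abstract
  _⊕_ _⊛_ : ℂ → ℂ → ℂ
  _⊕_ = _+_
  _⊛_ = _*_

  ⊝_ : ℂ → ℂ
  ⊝_ = -_

  +≡⊕ : ∀ z w → z + w ≡ z ⊕ w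
  +≡⊕ z w = refl

  *≡⊛ : ∀ z w → z * w ≡ z ⊛ w
  *≡⊛ z w = refl

  -≡⊝ : ∀ z → - z ≡ ⊝ z
  -≡⊝ z = refl

module _ where
  open ℚ-Solver.+-*-Solver
  abstract
    ≋-refl : ∀ {z} → z ≋ z
    ≋-refl {z} = wrap (≈ℝ-refl (re z) , ≈ℝ-refl (im z))

    ≋-sym : ∀ {z w} → z ≋ w → w ≋ z
    ≋-sym {z} {w} (wrap (p , q)) = wrap (≈ℝ-sym {re z} {re w} p , ≈ℝ-sym {im z} {im w} q)

    ≋-trans : ∀ {z w v} → z ≋ w → w ≋ v → z ≋ v
    ≋-trans {z} {w} {v} (wrap (p , q)) (wrap (r , s)) =
      wrap (≈ℝ-trans {re z} {re w} {re v} p r , ≈ℝ-trans {im z} {im w} {im v} q s)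

    +-cong : ∀ {x y u v} → x ≋ y → u ≋ v → x ⊕ u ≋ y ⊕ v
    +-cong {x} {y} {u} {v} (wrap (p , q)) (wrap (r , s)) = wrap
      (+ℝ-cong {re x} {re y} {re u} {re v} p r , +ℝ-cong {im x} {im y} {im u} {im v} q s)

    neg-cong : ∀ {x y} → x ≋ y → ⊝ x ≋ ⊝ y
    neg-cong {x} {y} (wrap (p , q)) = wrap (-ℝ-cong {re x} {re y} p , -ℝ-cong {im x} {im y} q)

    *-cong : ∀ {x y u v} → x ≋ y → u ≋ v → x ⊛ u ≋ y ⊛ v
    *-cong {x} {y} {u} {v} (wrap (p , q)) (wrap (r , s)) = wrap
      ( +ℝ-cong {re x *ℝ re u} {re y *ℝ re v} { -ℝ (im x *ℝ im u)} { -ℝ (im y *ℝ im v)}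
          (*ℝ-cong {re x} {re y} {re u} {re v} p r)
          (-ℝ-cong {im x *ℝ im u} {im y *ℝ im v} (*ℝ-cong {im x} {im y} {im u} {im v} q s))
      , +ℝ-cong {re x *ℝ im u} {re y *ℝ im v} {im x *ℝ re u} {im y *ℝ re v}
          (*ℝ-cong {re x} {re y} {im u} {im v} p s)
          (*ℝ-cong {im x} {im y} {re u} {re v} q r))

    conj-cong : ∀ {z w} → z ≋ w → conj z ≋ conj w
    conj-cong {z} {w} (wrap (p , q)) = wrap (p , -ℝ-cong {im z} {im w} q)

    +-assoc : ∀ x y z → (x ⊕ y) ⊕ z ≋ x ⊕ (y ⊕ z)
    +-assoc x y z = pointwise⇒≋ ((x ⊕ y) ⊕ z) (x ⊕ (y ⊕ z))
      (λ n → ℚ.+-assoc (seq (re x) n) (seq (re y) n) (seq (re z) n))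
      (λ n → ℚ.+-assoc (seq (im x) n) (seq (im y) n) (seq (im z) n))

    +-comm : ∀ x y → x ⊕ y ≋ y ⊕ x
    +-comm x y = pointwise⇒≋ (x ⊕ y) (y ⊕ x)
      (λ n → ℚ.+-comm (seq (re x) n) (seq (re y) n))
      (λ n → ℚ.+-comm (seq (im x) n) (seq (im y) n))

    +-identityˡ : ∀ x → 0ℂ ⊕ x ≋ x
    +-identityˡ x = pointwise⇒≋ (0ℂ ⊕ x) x
      (λ n → ℚ.+-identityˡ (seq (re x) n)) (λ n → ℚ.+-identityˡ (seq (im x) n))

    -‿inverseˡ : ∀ x → ⊝ x ⊕ x ≋ 0ℂ
    -‿inverseˡ x = pointwise⇒≋ (⊝ x ⊕ x) 0ℂ
      (λ n → ℚ.+-inverseˡ (seq (re x) n)) (λ n → ℚ.+-inverseˡ (seq (im x) n))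

    *-assoc : ∀ x y z → (x ⊛ y) ⊛ z ≋ x ⊛ (y ⊛ z)
    *-assoc x y z = pointwise⇒≋ ((x ⊛ y) ⊛ z) (x ⊛ (y ⊛ z))
      (λ n → solve 6 (λ a b c d e f →
          (a :* c :+ :- (b :* d)) :* e :+ :- ((a :* d :+ b :* c) :* f)
          := a :* (c :* e :+ :- (d :* f)) :+ :- (b :* (c :* f :+ d :* e))) refl
        (seq (re x) n) (seq (im x) n) (seq (re y) n) (seq (im y) n) (seq (re z) n) (seq (im z) n))
      (λ n → solve 6 (λ a b c d e f →
          (a :* c :+ :- (b :* d)) :* f :+ (a :* d :+ b :* c) :* e
          := a :* (c :* f :+ d :* e) :+ b :* (c :* e :+ :- (d :* f))) refl
        (seq (re x) n) (seq (im x) n) (seq (re y) n) (seq (im y) n) (seq (re z) n) (seq (im z) n))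

    *-comm : ∀ x y → x ⊛ y ≋ y ⊛ x
    *-comm x y = pointwise⇒≋ (x ⊛ y) (y ⊛ x)
      (λ n → solve 4 (λ a b c d → a :* c :+ :- (b :* d) := c :* a :+ :- (d :* b)) refl
        (seq (re x) n) (seq (im x) n) (seq (re y) n) (seq (im y) n))
      (λ n → solve 4 (λ a b c d → a :* d :+ b :* c := c :* b :+ d :* a) refl
        (seq (re x) n) (seq (im x) n) (seq (re y) n) (seq (im y) n))

    *-identityˡ : ∀ x → 1ℂ ⊛ x ≋ x
    *-identityˡ x = pointwise⇒≋ (1ℂ ⊛ x) x
      (λ n → solve 2 (λ a b → con 1ℚ :* a :+ :- (con 0ℚ :* b) := a) refl (seq (re x) n) (seq (im x) n))
      (λ n → solve 2 (λ a b → con 1ℚ :* b :+ con 0ℚ :* a := b) refl (seq (re x) n) (seq (im x) n))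

    *-distribʳ-+ : ∀ x y z → (y ⊕ z) ⊛ x ≋ y ⊛ x ⊕ z ⊛ x
    *-distribʳ-+ x y z = pointwise⇒≋ ((y ⊕ z) ⊛ x) (y ⊛ x ⊕ z ⊛ x)
      (λ n → solve 6 (λ a b c d e f →
          (c :+ e) :* a :+ :- ((d :+ f) :* b)
          := (c :* a :+ :- (d :* b)) :+ (e :* a :+ :- (f :* b))) refl
        (seq (re x) n) (seq (im x) n) (seq (re y) n) (seq (im y) n) (seq (re z) n) (seq (im z) n))
      (λ n → solve 6 (λ a b c d e f →
          (c :+ e) :* b :+ (d :+ f) :* a
          := (c :* b :+ d :* a) :+ (e :* b :+ f :* a)) refl
        (seq (re x) n) (seq (im x) n) (seq (re y) n) (seq (im y) n) (seq (re z) n) (seq (im z) n))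

    +-identityʳ : ∀ x → x ⊕ 0ℂ ≋ x
    +-identityʳ x = ≋-trans {x ⊕ 0ℂ} {0ℂ ⊕ x} {x} (+-comm x 0ℂ) (+-identityˡ x)

    -‿inverseʳ : ∀ x → x ⊕ ⊝ x ≋ 0ℂ
    -‿inverseʳ x = ≋-trans {x ⊕ ⊝ x} { ⊝ x ⊕ x} {0ℂ} (+-comm x (⊝ x)) (-‿inverseˡ x)

    *-identityʳ : ∀ x → x ⊛ 1ℂ ≋ x
    *-identityʳ x = ≋-trans {x ⊛ 1ℂ} {1ℂ ⊛ x} {x} (*-comm x 1ℂ) (*-identityˡ x)

    *-distribˡ-+ : ∀ x y z → x ⊛ (y ⊕ z) ≋ x ⊛ y ⊕ x ⊛ z
    *-distribˡ-+ x y z = ≋-trans {x ⊛ (y ⊕ z)} {(y ⊕ z) ⊛ x} {x ⊛ y ⊕ x ⊛ z} (*-comm x (y ⊕ z))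
      (≋-trans {(y ⊕ z) ⊛ x} {y ⊛ x ⊕ z ⊛ x} {x ⊛ y ⊕ x ⊛ z} (*-distribʳ-+ x y z)
        (+-cong {y ⊛ x} {x ⊛ y} {z ⊛ x} {x ⊛ z} (*-comm y x) (*-comm z x)))

    conj-* : ∀ z w → conj (z ⊛ w) ≋ conj z ⊛ conj w
    conj-* z w = pointwise⇒≋ (conj (z ⊛ w)) (conj z ⊛ conj w)
      (λ n → solve 4 (λ a b c d → a :* c :+ :- (b :* d) := a :* c :+ :- ((:- b) :* (:- d))) refl
        (seq (re z) n) (seq (im z) n) (seq (re w) n) (seq (im w) n))
      (λ n → solve 4 (λ a b c d → :- (a :* d :+ b :* c) := a :* (:- d) :+ (:- b) :* c) refl
        (seq (re z) n) (seq (im z) n) (seq (re w) n) (seq (im w) n))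

    conj-fromℚℂ : ∀ q → conj (fromℚℂ q) ≋ fromℚℂ q
    conj-fromℚℂ q = pointwise⇒≋ (conj (fromℚℂ q)) (fromℚℂ q) (λ _ → refl) (λ _ → refl)

    fromℚℂ-+ : ∀ p q → fromℚℂ (p ℚ.+ q) ≋ fromℚℂ p ⊕ fromℚℂ q
    fromℚℂ-+ p q = pointwise⇒≋ (fromℚℂ (p ℚ.+ q)) (fromℚℂ p ⊕ fromℚℂ q) (λ _ → refl) (λ _ → refl)

    fromℚℂ-* : ∀ p q → fromℚℂ (p ℚ.* q) ≋ fromℚℂ p ⊛ fromℚℂ q
    fromℚℂ-* p q = pointwise⇒≋ (fromℚℂ (p ℚ.* q)) (fromℚℂ p ⊛ fromℚℂ q)
      (λ _ → solve 2 (λ p q → p :* q := p :* q :+ :- (con 0ℚ :* con 0ℚ)) refl p q)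
      (λ _ → solve 2 (λ p q → con 0ℚ := p :* con 0ℚ :+ con 0ℚ :* q) refl p q)

    fromℚℂ-neg : ∀ q → fromℚℂ (ℚ.- q) ≋ ⊝ fromℚℂ q
    fromℚℂ-neg q = pointwise⇒≋ (fromℚℂ (ℚ.- q)) (⊝ fromℚℂ q) (λ _ → refl) (λ _ → refl)

    -- By the triangle inequality, a real part within `½ q` of `q` stays at distance at least `½ q`
    -- from zero.
    ≋fromℚℂ⇒#0 : ∀ z q → .{{Positive q}} → z ≋ fromℚℂ q → z # 0ℂ
    ≋fromℚℂ⇒#0 z q (wrap (z≈q , _)) with z≈q (½ ℚ.* q) {{½ε q}}
    ... | N , close = inj₁ (½ ℚ.* q , ½ε q , N , λ n n≥ → begin
      ½ ℚ.* q                                      ≡⟨ lemma q ⟩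
      q ℚ.- ½ ℚ.* q                                ≤⟨ ℚ.+-monoʳ-≤ q (ℚ.neg-antimono-≤ (ℚ.<⇒≤ (close n n≥))) ⟩
      q ℚ.- ℚ.∣ seq (re z) n ℚ.- q ∣
        ≡⟨ cong (ℚ._- ℚ.∣ seq (re z) n ℚ.- q ∣) (ℚ.0≤p⇒∣p∣≡p (ℚ.<⇒≤ (ℚ.positive⁻¹ q))) ⟨
      ℚ.∣ q ∣ ℚ.- ℚ.∣ seq (re z) n ℚ.- q ∣
        ≡⟨ cong (λ r → ℚ.∣ r ∣ ℚ.- ℚ.∣ seq (re z) n ℚ.- q ∣) (split (seq (re z) n)) ⟩
      ℚ.∣ (seq (re z) n ℚ.- 0ℚ) ℚ.+ ℚ.- (seq (re z) n ℚ.- q) ∣ ℚ.- ℚ.∣ seq (re z) n ℚ.- q ∣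
        ≤⟨ ℚ.+-monoˡ-≤ _ (ℚ.∣p+q∣≤∣p∣+∣q∣ (seq (re z) n ℚ.- 0ℚ) (ℚ.- (seq (re z) n ℚ.- q))) ⟩
      (ℚ.∣ seq (re z) n ℚ.- 0ℚ ∣ ℚ.+ ℚ.∣ ℚ.- (seq (re z) n ℚ.- q) ∣) ℚ.- ℚ.∣ seq (re z) n ℚ.- q ∣
        ≡⟨ cong (λ r → (ℚ.∣ seq (re z) n ℚ.- 0ℚ ∣ ℚ.+ r) ℚ.- ℚ.∣ seq (re z) n ℚ.- q ∣) (ℚ.∣-p∣≡∣p∣ (seq (re z) n ℚ.- q)) ⟩
      (ℚ.∣ seq (re z) n ℚ.- 0ℚ ∣ ℚ.+ ℚ.∣ seq (re z) n ℚ.- q ∣) ℚ.- ℚ.∣ seq (re z) n ℚ.- q ∣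
        ≡⟨ solve 2 (λ a b → (a :+ b) :- b := a) refl ℚ.∣ seq (re z) n ℚ.- 0ℚ ∣ ℚ.∣ seq (re z) n ℚ.- q ∣ ⟩
      ℚ.∣ seq (re z) n ℚ.- 0ℚ ∣ ∎)
      where
      open ℚ.≤-Reasoning
      lemma : ∀ q → ½ ℚ.* q ≡ q ℚ.- ½ ℚ.* q
      lemma = solve 1 (λ q → con ½ :* q := q :- con ½ :* q) refl
      split : ∀ r → q ≡ (r ℚ.- 0ℚ) ℚ.+ ℚ.- (r ℚ.- q)
      split r = solve 2 (λ q r → q := (r :- con 0ℚ) :+ :- (r :- q)) refl q r

ℂ-commutativeRing : CommutativeRing 0ℓ 0ℓ
ℂ-commutativeRing = record
  { Carrier = ℂ ; _≈_ = _≋_ ; _+_ = _⊕_ ; _*_ = _⊛_ ; -_ = ⊝_ ; 0# = 0ℂ ; 1# = 1ℂ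
  ; isCommutativeRing = record
    { isRing = record
      { +-isAbelianGroup = record
        { isGroup = record
          { isMonoid = record
            { isSemigroup = record
              { isMagma = record
                { isEquivalence = record { refl = ≋-refl ; sym = ≋-sym ; trans = ≋-trans }
                ; ∙-cong = λ {x} {y} {u} {v} → +-cong {x} {y} {u} {v} }
              ; assoc = +-assoc }
            ; identity = +-identityˡ , +-identityʳ }
          ; inverse = -‿inverseˡ , -‿inverseʳ
          ; ⁻¹-cong = λ {x} {y} → neg-cong {x} {y} }
        ; comm = +-comm }
      ; *-cong = λ {x} {y} {u} {v} → *-cong {x} {y} {u} {v}
      ; *-assoc = *-assoc
      ; *-identity = *-identityˡ , *-identityʳ
      ; distrib = *-distribˡ-+ , *-distribʳ-+ }
    ; *-comm = *-comm } }

-- Comparison of tensors over the ring ℂ with the concrete ones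

private module T = Tensors ℂ-commutativeRing
open T using (ε; ord; ord-∏; *-congˡ; *-congʳ; module ≈-Reasoning) renaming (≡⇒≈ to ≡⇒≋)
private module S = T.OverRationals fromℚℂ fromℚℂ-+ fromℚℂ-* fromℚℂ-neg ≋-refl ≋-refl
open S hiding (evaluate; -1^)

-- The factors of a product in ℂ are explicit, since _*_ unfolds.
*≋⊛ : ∀ x u {y v} → x ≋ y → u ≋ v → x * u ≋ y ⊛ v
*≋⊛ x u {y} {v} x≋y u≋v = ≋-trans (≡⇒≋ (*≡⊛ x u)) (*-cong x≋y u≋v)

∑≋ : ∀ {A : Set} (xs : List A) {f g} → (∀ x → f x ≋ g x) → ∑ xs f ≋ T.∑ xs g
∑≋ []       f≋g = ≋-refl
∑≋ (x ∷ xs) {f} f≋g = ≋-trans (≡⇒≋ (+≡⊕ (f x) (∑ xs f))) (+-cong (f≋g x) (∑≋ xs f≋g))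

∏≋ : ∀ {n} (zs : Vec ℂ n) → ∏ zs ≋ T.∏ zs
∏≋ []       = ≋-refl
∏≋ (z ∷ zs) = *≋⊛ z (∏ zs) ≋-refl (∏≋ zs)

pure≋ : ∀ {A B : Set} {d} (f : A → Space B) (as : Vec A d) bs →
  pure (Vec.map f as) bs ≋ T.∏ (Vec.zipWith f as bs)
pure≋ f as bs = ≋-trans (≡⇒≋ (cong ∏ (entries as bs))) (∏≋ (Vec.zipWith f as bs))
  where
  entries : ∀ {k} as (bs : Vec _ k) → Vec.zipWith (λ v b → v b) (Vec.map f as) bs ≡ Vec.zipWith f as bs
  entries []       []       = refl
  entries (a ∷ as) (b ∷ bs) = cong (f a b ∷_) (entries as bs)

e≡ : ∀ {n} (i j : Fin n) → e i j ≡ T.e i j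
e≡ i j with i Fin.≟ j
... | yes _ = refl
... | no _  = refl

-- The coordinate `i` of the transpose of `g` applied to `e j` is `g j i`.
act≋ : ∀ {m n} (g : Matrix n) (w : ⨂ m (Fin n)) I → act (g ᵗ) w I ≋ T.act g w I
act≋ {m} {n} g w I = ∑≋ (indices m n) (λ J →
  *≋⊛ (w J) (pure (Vec.map (λ j → (g ᵗ) · e j) J) I) ≋-refl
    (≋-trans (pure≋ (λ j → (g ᵗ) · e j) J I) (T.∏-zipWith-cong J I column)))
  where
  column : ∀ j i → ((g ᵗ) · e j) i ≋ g j i
  column j i = ≋-trans
    (∑≋ (List.allFin n) (λ l → *≋⊛ ((g ᵗ) i l) (e j l) ≋-refl (≋-trans (≡⇒≋ (e≡ j l)) (T.e-sym j l))))
    (T.∑-e (λ l → g l i) j)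

-1^≋ : ∀ r → -1^ r ≋ S.-1^ r
-1^≋ zero    = ≋-refl
-1^≋ (suc r) = ≋-trans (≡⇒≋ (-≡⊝ (-1^ r))) (neg-cong (-1^≋ r))

count-yes : ∀ {A : Set} {P : A → Set} (P? : Decidable P) {n x} (xs : Vec A n) →
  P x → Vec.count P? (x ∷ xs) ≡ suc (Vec.count P? xs)
count-yes P? {x = x} xs px with P? x
... | yes _  = refl
... | no ¬px = ⊥-elim (¬px px)

count-no : ∀ {A : Set} {P : A → Set} (P? : Decidable P) {n x} (xs : Vec A n) →
  ¬ P x → Vec.count P? (x ∷ xs) ≡ Vec.count P? xs
count-no P? {x = x} xs ¬px with P? x
... | yes px = ⊥-elim (¬px px)
... | no _   = refl

-- For distinct letters, `ord i j` is -1 exactly when `j` is smaller than `i`, that is, at the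
-- inversions.
sgn≋ε : ∀ {m n} (π : Vec (Fin n) m) → VecUnique π → sgn π ≋ ε (toList π)
sgn≋ε π u = ≋-trans (-1^≋ (inversions π)) (go π u)
  where
  row : ∀ {k n} {i : Fin n} (js : Vec (Fin n) k) → VecAll.All (i ≢_) js →
    S.-1^ (Vec.count (Fin._<? i) js) ≋ ord-∏ i (toList js)
  row []       _                    = ≋-refl
  row {i = i} (j ∷ js) (i≢j VecAll.∷ i≢js) with Fin.<-cmp i j
  ... | tri< _ _ j≮i = ≋-trans (≡⇒≋ (cong S.-1^ (count-no (Fin._<? i) js j≮i)))
          (≋-trans (row js i≢js) (≋-sym (*-identityˡ _)))
  ... | tri≈ _ i≡j _ = ⊥-elim (i≢j i≡j)
  ... | tri> _ _ j<i = ≋-trans (≡⇒≋ (cong S.-1^ (count-yes (Fin._<? i) js j<i)))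
          (≋-trans (neg-cong (row js i≢js)) (≋-sym (T.-1*x≈-x _)))
  go : ∀ {m n} (π : Vec (Fin n) m) → VecUnique π → S.-1^ (inversions π) ≋ ε (toList π)
  go []      _                    = ≋-refl
  go (i ∷ π) (i# VecAllPairs.∷ u) = ≋-trans
    (-1^-+ (Vec.count (Fin._<? i) π) (inversions π)) (*-cong (row π i#) (go π u))

-- The common bridge for `det` and `wedge`: words outside `𝔖 n` have a repetition, where `ε` is
-- zero.
∑-𝔖 : ∀ n (f g : Vec (Fin n) n → ℂ) → (∀ π → f π ≋ g π) →
  ∑ (𝔖 n) (λ π → sgn π * f π) ≋ T.∑ (indices n n) (λ π → ε (toList π) ⊛ g π)
∑-𝔖 n f g f≋g = ≋-trans (∑≋ (𝔖 n) (λ π → ≡⇒≋ (*≡⊛ (sgn π) (f π))))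
  (T.∑-filter unique? (indices n n) (λ π u → *-cong (sgn≋ε π u) (f≋g π))
    (λ π ¬u → ≋-trans (*-congʳ (repeated π ¬u)) (T.zeroˡ (g π))))
  where
  repeated : ∀ π → ¬ VecUnique π → ε (toList π) ≋ 0ℂ
  repeated π ¬u with unique-or-repetition Fin._≟_ (toList π)
  ... | inj₁ u           = ⊥-elim (¬u (toList-Unique⁻ π u))
  ... | inj₂ (_ , _ , p) = T.Halving.alternating-vanish (fromℚℂ ½) ½+½≈1 {α = ε} T.ε-alternating p

det≋ : ∀ {n} (g : Matrix n) → det g ≋ T.det g
det≋ {n} g = ∑-𝔖 n (λ π → ∏ (Vec.zipWith g (Vec.allFin n) π)) (λ π → T.∏ (Vec.zipWith g (Vec.allFin n) π))
  (λ π → ∏≋ (Vec.zipWith g (Vec.allFin n) π))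

1/_! : ℕ → ℚ
1/ n ! = (1ℤ ℚ./ n ℕ.!) {{n ℕ.!≢0}}

wedge≋ : ∀ n I → wedge n I ≋ fromℚℂ (1/ n !) ⊛ ε (toList I)
wedge≋ n I = *≋⊛ (fromℚℂ ((1ℤ ℚ./ n ℕ.!) {{n ℕ.!≢0}})) (∑ (𝔖 n) (λ π → sgn π * pure (Vec.map e π) I)) ≋-refl
  (≋-trans (∑-𝔖 n (λ π → pure (Vec.map e π) I) (λ π → T.∏ (Vec.zipWith T.e π I)) (λ π →
    ≋-trans (pure≋ e π I) (T.∏-zipWith-cong π I (λ j i → ≡⇒≋ (e≡ j i)))))
    (T.∑-δ (ε ∘ toList) I))

-- All factors are 0, 1 or -1. Hence the conjugation in the inner product does not affect the
-- coefficients of the Pfaffian.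
conj-ε : ∀ {n} (is : List (Fin n)) → conj (ε is) ≋ ε is
conj-ε []       = conj-fromℚℂ 1ℚ
conj-ε (i ∷ is) = ≋-trans (conj-* (ord-∏ i is) (ε is)) (*-cong (row is) (conj-ε is))
  where
  conj-ord : ∀ j → conj (ord i j) ≋ ord i j
  conj-ord j with Fin.<-cmp i j
  ... | tri< _ _ _ = conj-fromℚℂ 1ℚ
  ... | tri≈ _ _ _ = conj-fromℚℂ 0ℚ
  ... | tri> _ _ _ = ≋-trans (conj-cong (≋-sym (fromℚℂ-neg 1ℚ))) (≋-trans (conj-fromℚℂ (ℚ.- 1ℚ)) (fromℚℂ-neg 1ℚ))
  row : ∀ js → conj (ord-∏ i js) ≋ ord-∏ i js
  row []       = conj-fromℚℂ 1ℚ
  row (j ∷ js) = ≋-trans (conj-* (ord i j) (ord-∏ i js)) (*-cong (conj-ord j) (row js))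

evaluate≋ : ∀ {m n d} (ts : Polynomial m n d) w → evaluate ts w ≋ S.evaluate ts w
evaluate≋ ts w = ∑≋ ts (λ t → *≋⊛ (proj₁ t) (∏ (Vec.map w (proj₂ t))) ≋-refl (∏≋ (Vec.map w (proj₂ t))))

evaluate-cong : ∀ {m n d} (ts : Polynomial m n d) {w w′ : ⨂ m (Fin n)} →
  (∀ I → w I ≋ w′ I) → S.evaluate ts w ≋ S.evaluate ts w′
evaluate-cong ts w≋w′ = T.∑-cong ts (λ t → *-congˡ (T.∏-cong (proj₂ t) w≋w′))

-- The two forms of the action agree only coordinatewise, which `f`, as an arbitrary function, is
-- not assumed to respect; its expression `ts` does respect it.
evaluate-invariant : ∀ {m n d} {f : ⨂ m (Fin n) → ℂ} (ts : Polynomial m n d) →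
  (∀ w → f w ≋ S.evaluate ts w) → IsInvariant f →
  ∀ g → T.det g ≋ 1ℂ → ∀ w → S.evaluate ts (T.act g w) ≋ S.evaluate ts w
evaluate-invariant {f = f} ts f≋ inv g det≋1 w = begin
  S.evaluate ts (T.act g w)      ≈⟨ evaluate-cong ts (λ I → ≋-sym (act≋ g w I)) ⟩
  S.evaluate ts (act (g ᵗ) w)    ≈⟨ f≋ (act (g ᵗ) w) ⟨
  f (act (g ᵗ) w)                ≈⟨ wrap (inv g (unwrap (≋-trans (det≋ g) det≋1)) w) ⟩
  f w                            ≈⟨ f≋ w ⟩
  S.evaluate ts w                ∎
  where open ≈-Reasoning

•≋ : ∀ {B : Set} c (v : Space B) b {x} → v b ≋ x → (c • v) b ≋ c ⊛ x
•≋ c v b vb≋x = *≋⊛ c (v b) ≋-refl vb≋x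

inner≋ : ∀ {B : Set} (bs : List B) (s t : Space B) {s′ t′ : Space B} →
  (∀ b → conj (s b) ≋ s′ b) → (∀ b → t b ≋ t′ b) → inner bs s t ≋ T.∑ bs (λ b → s′ b ⊛ t′ b)
inner≋ bs s t s≋ t≋ = ∑≋ bs (λ b → *≋⊛ (conj (s b)) (t b) (s≋ b) (t≋ b))

blocks≋ : ∀ {B : Set} d m .(eq : d *ℕ m ≡ d *ℕ m) {t t′ : ⨂ (d *ℕ m) B} → (∀ I → t I ≋ t′ I) →
  ∀ Js → blocks d m eq t Js ≋ t′ (concat Js)
blocks≋ d m eq {t′ = t′} t≋t′ Js = ≋-trans (t≋t′ (Vec.cast eq (concat Js)))
  (≡⇒≋ (cong t′ (Vec.cast-is-id eq (concat Js))))

-- The invariants of ⨂^m ℂ^n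

module _ (m d : ℕ) where
  private
    𝕀 = tuples (indices m (d *ℕ m)) d
    Pfaffian : ⨂ m (Fin (d *ℕ m)) → ℂ
    Pfaffian = Pf m d

  multiple-invariant : ∀ {f : ⨂ m (Fin (d *ℕ m)) → ℂ} c → (∀ w → f w ≋ c ⊛ Pfaffian w) → Invariants m (d *ℕ m) d f
  multiple-invariant {f} c f≋ = (List.map term 𝕀 , homogeneous) , invariant
    where
    open ≈-Reasoning
    term : Vec (Vec (Fin (d *ℕ m)) m) d → ℂ × Vec (Vec (Fin (d *ℕ m)) m) d
    term Js = c ⊛ ε (toList (concat Js)) , Js
    monomial : ⨂ m (Fin (d *ℕ m)) → ℂ × Vec (Vec (Fin (d *ℕ m)) m) d → ℂ
    monomial w t = proj₁ t ⊛ T.∏ (Vec.map w (proj₂ t))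
    homogeneous : ∀ w → f w ≈ evaluate (List.map term 𝕀) w
    homogeneous w = unwrap (begin
      f w                                    ≈⟨ f≋ w ⟩
      c ⊛ Pfaffian w                         ≈⟨ T.∑-*ˡ c 𝕀 _ ⟩
      T.∑ 𝕀 (λ Js → c ⊛ (ε (toList (concat Js)) ⊛ T.∏ (Vec.map w Js)))
                                             ≈⟨ T.∑-cong 𝕀 (λ Js → ≋-sym (*-assoc _ _ _)) ⟩
      T.∑ 𝕀 (monomial w ∘ term)              ≈⟨ ≡⇒≋ (T.∑-map term 𝕀 (monomial w)) ⟨
      S.evaluate (List.map term 𝕀) w         ≈⟨ evaluate≋ (List.map term 𝕀) w ⟨
      evaluate (List.map term 𝕀) w           ∎)
    Pf-cong : ∀ {w w′} → (∀ I → w I ≋ w′ I) → Pfaffian w ≋ Pfaffian w′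
    Pf-cong w≋w′ = T.∑-cong 𝕀 (λ Js → *-congˡ (T.∏-cong Js w≋w′))
    invariant : IsInvariant f
    invariant g det≈1 w = unwrap (begin
      f (act (g ᵗ) w)              ≈⟨ f≋ (act (g ᵗ) w) ⟩
      c ⊛ Pfaffian (act (g ᵗ) w)   ≈⟨ *-congˡ (Pf-cong (act≋ g w)) ⟩
      c ⊛ Pfaffian (T.act g w)     ≈⟨ *-congˡ (Pf-act m d g w) ⟩
      c ⊛ (T.det g ⊛ Pfaffian w)   ≈⟨ *-congˡ (*-congʳ (≋-trans (≋-sym (det≋ g)) (wrap det≈1))) ⟩
      c ⊛ (1ℂ ⊛ Pfaffian w)        ≈⟨ *-congˡ (*-identityˡ (Pfaffian w)) ⟩
      c ⊛ Pfaffian w               ≈⟨ f≋ w ⟨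
      f w                          ∎)

  invariant-multiple : Fin (d *ℕ m) → ∀ {f : ⨂ m (Fin (d *ℕ m)) → ℂ} → Invariants m (d *ℕ m) d f →
    ∃ λ c → ∀ w → f w ≋ c ⊛ Pfaffian w
  invariant-multiple i₀ {f} ((ts , f≈) , inv) = proj₁ classified , λ w → ≋-trans (f≋ w) (proj₂ classified w)
    where
    f≋ : ∀ w → f w ≋ S.evaluate ts w
    f≋ w = ≋-trans (wrap (f≈ w)) (evaluate≋ ts w)
    classified = top-degree ts i₀ (evaluate-invariant ts f≋ inv)

  module _ .(eq : (d *ℕ m) ≡ (d *ℕ m)) where
    private
      coefficient≋ : ∀ Js → blocks d m eq (wedge (d *ℕ m)) Js ≋ fromℚℂ (1/ (d *ℕ m) !) ⊛ ε (toList (concat Js))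
      coefficient≋ = blocks≋ d m eq {wedge (d *ℕ m)} {λ I → fromℚℂ (1/ (d *ℕ m) !) ⊛ ε (toList I)} (wedge≋ (d *ℕ m))

    blocks-wedge-symmetric : S.-1^ m ≋ 1ℂ → IsSymmetric (blocks d m eq (wedge (d *ℕ m)))
    blocks-wedge-symmetric even σ Js = unwrap (begin
      blocks d m eq (wedge (d *ℕ m)) (permuteFactors σ Js)
        ≈⟨ coefficient≋ (permuteFactors σ Js) ⟩
      fromℚℂ (1/ (d *ℕ m) !) ⊛ ε (toList (concat (permuteFactors σ Js)))
        ≈⟨ *-congˡ (ε-blocks even Js (permuteFactors σ Js) (permuteFactors-↭ σ Js)) ⟩
      fromℚℂ (1/ (d *ℕ m) !) ⊛ ε (toList (concat Js))
        ≈⟨ coefficient≋ Js ⟨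
      blocks d m eq (wedge (d *ℕ m)) Js ∎)
      where open ≈-Reasoning

    private
      instance
        1/n!-positive : Positive (1/ (d *ℕ m) !)
        1/n!-positive = ℚ.normalize-pos 1 ((d *ℕ m) ℕ.!) {{(d *ℕ m) ℕ.!≢0}}
        1/n!-nonZero : ℚ.NonZero (1/ (d *ℕ m) !)
        1/n!-nonZero = ℚ.pos⇒nonZero (1/ (d *ℕ m) !)

    -- Taken as the inverse of the coefficient `1/n!` of `wedge`, so that it cancels that
    -- coefficient by the inverse law and inherits its positivity.
    n! : ℂ
    n! = fromℚℂ (ℚ.1/ (1/ (d *ℕ m) !))

    n!#0 : n! # 0ℂ
    n!#0 = ≋fromℚℂ⇒#0 n! (ℚ.1/ (1/ (d *ℕ m) !)) {{ℚ.1/pos⇒pos (1/ (d *ℕ m) !)}} ≋-refl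

    Pf≈polynomialOf : ∀ w → Pfaffian w ≈ polynomialOf (n! • blocks d m eq (wedge (d *ℕ m))) w
    Pf≈polynomialOf w = unwrap (≋-sym (inner≋ 𝕀 (n! • blocks d m eq (wedge (d *ℕ m))) (w ^⊗ d)
      {λ Js → ε (toList (concat Js))} {λ Js → T.∏ (Vec.map w Js)} coefficient monomial))
      where
      open ≈-Reasoning
      cancel : ∀ z → n! ⊛ (fromℚℂ (1/ (d *ℕ m) !) ⊛ z) ≋ z
      cancel z = begin
        n! ⊛ (fromℚℂ (1/ (d *ℕ m) !) ⊛ z)    ≈⟨ *-assoc n! (fromℚℂ (1/ (d *ℕ m) !)) z ⟨
        n! ⊛ fromℚℂ (1/ (d *ℕ m) !) ⊛ z      ≈⟨ *-congʳ (fromℚℂ-* (ℚ.1/ (1/ (d *ℕ m) !)) (1/ (d *ℕ m) !)) ⟨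
        fromℚℂ (ℚ.1/ (1/ (d *ℕ m) !) ℚ.* (1/ (d *ℕ m) !)) ⊛ z
          ≈⟨ *-congʳ (≡⇒≋ (cong fromℚℂ (ℚ.*-inverseˡ (1/ (d *ℕ m) !)))) ⟩
        1ℂ ⊛ z                               ≈⟨ *-identityˡ z ⟩
        z                                    ∎
      coefficient : ∀ Js → conj ((n! • blocks d m eq (wedge (d *ℕ m))) Js) ≋ ε (toList (concat Js))
      coefficient Js = ≋-trans
        (conj-cong {(n! • blocks d m eq (wedge (d *ℕ m))) Js} {ε (toList (concat Js))}
          (≋-trans (•≋ n! (blocks d m eq (wedge (d *ℕ m))) Js (coefficient≋ Js)) (cancel (ε (toList (concat Js))))))
        (conj-ε (toList (concat Js)))
      entries : ∀ {k} (Js : Vec (Vec (Fin (d *ℕ m)) m) k) →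
        Vec.zipWith (λ v b → v b) (Vec.replicate k w) Js ≡ Vec.map w Js
      entries []       = refl
      entries (J ∷ Js) = cong (w J ∷_) (entries Js)
      monomial : ∀ Js → (w ^⊗ d) Js ≋ T.∏ (Vec.map w Js)
      monomial Js = ≋-trans (≡⇒≋ (cong ∏ (entries Js))) (∏≋ (Vec.map w Js))

Pf#0 : ∀ m d → S.-1^ (suc m) ≋ 1ℂ → ∃ λ w → Pf (suc m) d w # 0ℂ
Pf#0 m d even with Pf-blockSum {m} {d} even
... | q , 1≤q , Pf≋q = blockSum {m} {d} even ,
  ≋fromℚℂ⇒#0 (Pf (suc m) d (blockSum {m} {d} even)) q
    {{ℚ.positive (ℚ.<-≤-trans (ℚ.positive⁻¹ 1ℚ) 1≤q)}} Pf≋q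

invariant⇔multiple : ∀ m d → Fin (d *ℕ m) → (f : ⨂ m (Fin (d *ℕ m)) → ℂ) →
  Invariants m (d *ℕ m) d f ⇔ (∃ λ c → ∀ w → f w ≈ c * Pf m d w)
invariant⇔multiple m d i₀ f = mk⇔ to from
  where
  to : Invariants m (d *ℕ m) d f → ∃ λ c → ∀ w → f w ≈ c * Pf m d w
  to inv = proj₁ multiple , λ w → unwrap (≋-trans (proj₂ multiple w) (≡⇒≋ (≡.sym (*≡⊛ (proj₁ multiple) (Pf m d w)))))
    where multiple = invariant-multiple m d i₀ {f} inv
  from : (∃ λ c → ∀ w → f w ≈ c * Pf m d w) → Invariants m (d *ℕ m) d f
  from (c , f≈) = multiple-invariant m d {f} c (λ w → ≋-trans (wrap (f≈ w)) (≡⇒≋ (*≡⊛ c (Pf m d w))))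

low-degree-zero : ∀ {m n d} {f : ⨂ m (Fin n) → ℂ} → 0 < d *ℕ m → d *ℕ m < n → Invariants m n d f → ∀ w → f w ≈ 0ℂ
low-degree-zero {f = f} dm>0 dm<n ((ts , f≈) , inv) w =
  unwrap (≋-trans (f≋ w) (low-degree ts dm>0 (evaluate-invariant ts f≋ inv) dm<n w))
  where
  f≋ : ∀ w → f w ≋ S.evaluate ts w
  f≋ w = ≋-trans (wrap (f≈ w)) (evaluate≋ ts w)

basis-of-invariants : ∀ m d .(eq : d *ℕ m ≡ d *ℕ m) → Fin (d *ℕ m) → S.-1^ m ≋ 1ℂ →
  (∃ λ w → Pf m d w # 0ℂ) →
  ∃ λ Pf →
    IsOneDimensionalWithBasis (Invariants m (d *ℕ m) d) Pf ×
    IsSymmetric (blocks d m eq (wedge (d *ℕ m))) ×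
    (∃ λ c → c # 0ℂ × (∀ w → Pf w ≈ polynomialOf (c • blocks d m eq (wedge (d *ℕ m))) w))
basis-of-invariants m d eq i₀ even w#0 =
  Pf m d
  , (multiple-invariant m d 1ℂ (λ w → ≋-sym (*-identityˡ (Pf m d w))) , w#0 , invariant⇔multiple m d i₀)
  , blocks-wedge-symmetric m d eq even
  , n! m d eq , n!#0 m d eq , Pf≈polynomialOf m d eq

proposition4p1 :
    ∀ (k n : ℕ) → 1 ≤ k → 1 ≤ n → (2k∣n : 2 *ℕ k ∣ n) →
    let d = quotient 2k∣n
        t = blocks d (2 *ℕ k) (≡.sym (_∣_.equality 2k∣n)) (wedge n)
    in
    (∃ λ Pf →
      IsOneDimensionalWithBasis (Invariants (2 *ℕ k) n d) Pf ×
      IsSymmetric t ×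
      (∃ λ c → c # 0ℂ × (∀ w → Pf w ≈ polynomialOf (c • t) w))) ×
    (∀ d′ → 0 < d′ → d′ < d →
      ∀ f → Invariants (2 *ℕ k) n d′ f → ∀ w → f w ≈ 0ℂ)
proposition4p1 (suc k) n _ 1≤n (divides d refl) =
  -- The hypothesis `1 ≤ n` supplies the column that carries the sign of a signed permutation.
  basis-of-invariants (2 *ℕ suc k) d (≡.sym refl) (Fin.fromℕ< 1≤n) (-1^-double (suc k))
    -- The first argument is the predecessor of the block length `2 *ℕ suc k`.
    (Pf#0 (k ℕ.+ suc (k ℕ.+ 0)) d (-1^-double (suc k)))
  , λ d′ 0<d′ d′<d f → low-degree-zero {2 *ℕ suc k} {d *ℕ (2 *ℕ suc k)} {d′} {f}
      (ℕ.*-mono-≤ 0<d′ (ℕ.s≤s ℕ.z≤n)) (ℕ.*-monoˡ-< (2 *ℕ suc k) d′<d)
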